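{- Let $G'$ be obtained from $G$ by increasing the weight of one edge $(a,b)$ from $\phi_{old}$ to $\phi_{new}$. Run Algorithm 4 (Pareto Search, Increase) on the stable tree labelling $L$ of $G$ over a stable tree hierarchy $T$ and on this update. Denote by $V_\Delta^+$ the set of vertices $v$ for which line 23 (the loop over the neighbors of $v$) is reached in Algorithm 4. Then $v\in V_\Delta^+$ if and only if $P_{G'}^r(v,r)$ differs from $P_G^r(v,r)$ for some ancestor $r\in\mathrm{Anc}(v)$.
   Context: A road network is a finite undirected graph $G=(V,E,\phi)$ with edge weights $\phi(u,v)\in\mathbb{R}_{\ge 0}$. A path is a sequence of vertices $(v_1,\dots,v_k)$ with $(v_i,v_{i+1})\in E$; its weight is $\sum_{i=1}^{k-1}\phi(v_i,v_{i+1})$. Shortest paths are paths of minimal weight and the distance is that weight ($\infty$ if no path exists). $N_G(v)=\{(u,\phi(u,v)): (u,v)\in E\}$. Two sets of shortest paths are regarded as different if they differ as sets of paths or if the length (weight) of the paths differs. A stable tree hierarchy over $G$ is a rooted binary tree $T=(\mathcal{N},\mathcal{E},\ell)$, where $\mathcal{N}$ is a set of tree nodes, $\mathcal{E}$ a set of tree edges, and $\ell:V(G)\to\mathcal{N}$ a total surjective function, such that: (1) for a constant $0<\beta\le 0.5$, each $N\in\mathcal{N}$ with left and right children $N_l,N_r$ satisfies $|T_\downarrow(N_l)|,|T_\downarrow(N_r)|\le(1-\beta)\,|T_\downarrow(N)|$, where $T_\downarrow(N)$ is the subtree rooted at $N$ (its size being the number of vertices of $G$ mapped by $\ell$ into it);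 (2) for any two vertices $s,t$, every path between $s$ and $t$ in $G$ contains a vertex of $\mathrm{Ca}(s,t)$, the set of vertices mapped by $\ell$ to common ancestors of $\ell(s)$ and $\ell(t)$ in $T$ (a node counts as an ancestor of itself). Fix an arbitrary total order $\preceq_t$ on $V$. Then $w\preceq v$ iff $\ell(w)$ is a strict ancestor of $\ell(v)$, or $\ell(w)=\ell(v)$ and $w\preceq_t v$. Put $\mathrm{Anc}(v)=\{w: w\preceq v\}$ (totally ordered by $\preceq$), $\mathrm{Desc}(w)=\{x: w\preceq x\}$; the label index is $\tau(v)=|\{w: w\preceq v,\ w\ne v\}|$. For $v,u\in\mathrm{Desc}(w)$, $d_G^w(v,u)$ and $P_G^w(v,u)$ are the distance and the set of shortest paths between $v$ and $u$ in the induced subgraph $G[\mathrm{Desc}(w)]$. The stable tree labelling $L$ of $G$ over $T$ stores for each vertex $v$ and each $0\le i\le\tau(v)$ the value $L_v[i]=d_G^w(v,w)$, where $w$ is the unique element of $\mathrm{Anc}(v)$ with $\tau(w)=i$. Algorithm 4 (Pareto Search, Increase), input $(a,b,\phi_{old},\phi_{new})$: set $\Delta=\phi_{new}-\phi_{old}$, call Search$(a,b,\phi_{old})$, then Search$(b,a,\phi_{old})$. Equality tests are considered false when the values are infinite. Search$(r,r',\phi)$: set $level(v)\leftarrow 0$ and $\mathit{affected}(v)$ undefined for all $v\in V$. Let $r_{\min}=\min(\tau(r),\tau(r'))$ and let $Q$ be a priority queue containing only $(\phi,r',[0,r_{\min}])$. Until $Q$ is empty, extract the tuple $(d,v,I)$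 with smallest $d$, ties being broken in favour of larger $I.max$ (here $I=[I.min,I.max]$ is an integer interval), and do the following. (i) Set $I.max\leftarrow\min(I.max,\tau(v))$ and $I.min\leftarrow\max(I.min,level(v))$. If $I.min>I.max$, continue with the next tuple. Otherwise set $level(v)\leftarrow I.max+1$. (ii) Start with $min,max$ undefined. For each $i\in I$ in increasing order: if $d+L_r[i]=L_v[i]$, then set $L_v[i]\leftarrow L_v[i]+\Delta$, set $min\leftarrow i$ if $min$ is undefined, and set $max\leftarrow i$. (iii) If $min$ is defined, then (line 23) for each $(n,\phi_n)\in N_G(v)$ (line 24) add $(d+\phi_n,n,[min,max])$ to $Q$; afterwards set $\mathit{affected}(v).min\leftarrow min$ if it is undefined, and set $\mathit{affected}(v).max\leftarrow max$. When $Q$ is empty, call Repair$(\mathit{affected})$. Repair$(\mathit{affected})$ (Algorithm 5), where $\mathit{affected}(v)$ is viewed as the interval $[\mathit{affected}(v).min,\mathit{affected}(v).max]$ (empty if undefined): start with an empty queue $Q$. For each $v$ with $\mathit{affected}(v)$ defined, each $(n,\phi_n)\in N_{G'}(v)$ and each $i\in\mathit{affected}(v)$ with $i\le\tau(n)$: if $L_n[i]+\phi_n<L_v[i]$, add $(L_n[i]+\phi_n,v,i)$ to $Q$. Then repeatedly extract $(d,v,i)$ with smallest $d$ until $Q$ is empty; if $d<L_v[i]$, set $L_v[i]\leftarrow d$ and, for each $(n,\phi_n)\in N_{G'}(v)$ with $i\in\mathit{affected}(n)$ and $L_v[i]+\phi_n<L_n[i]$, add $(L_v[i]+\phi_n,n,i)$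 to $Q$. Line 23 counts as reached for $v$ if it is reached in either of the two calls of Search.
   Formalization: The old weight of the updated edge (a,b) is assumed positive, since for weight 0 the claim fails (path a–b–c with weights 0 and 1, chain hierarchy, new weight 1: c is never reached); weights lie in any ordered field with decidable order, of which the reals are classically one. -}

module Defs where

open import Level using (0ℓ; _⊔_) renaming (suc to lsuc)
open import Algebra.Bundles using (CommutativeRing)
import Algebra.Definitions.RawMonoid as RawMonoidDefs
open import Data.Bool.Base using (Bool; true; false; if_then_else_; _∧_)
open import Data.Fin.Base using (Fin)
open import Data.Fin.Properties using (_≟_)
open import Data.List.Base
  using (List; []; _∷_; _++_; allFin; concatMap; filter; filterᵇ; foldl; head; last; map; upTo)
open import Data.List.Membership.Propositional using (_∈_)
open import Data.List.Relation.Binary.Permutation.Propositional using (_↭_)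
open import Data.List.Relation.Unary.All using (All)
open import Data.List.Relation.Unary.Any using (Any)
open import Data.List.Relation.Unary.Linked using (Linked)
open import Data.Maybe.Base using (Maybe; just; nothing; maybe′)
open import Data.Nat.Base as ℕ using (ℕ; suc; _∸_)
import Data.Nat.Properties as ℕ
open import Data.Product.Base using (_×_; _,_; proj₁; proj₂; ∃)
open import Data.Sum.Base using (_⊎_; inj₁; inj₂)
import Data.Vec.Base as Vec
open import Data.Vec.Functional using (updateAt)
open import Function.Base using (_∘_; const)
open import Function.Bundles using (_⇔_)
open import Function.Definitions using (Surjective)
open import Relation.Binary.Core using (Rel)
open import Relation.Binary.Definitions using (Decidable; Symmetric)
open import Relation.Binary.PropositionalEquality.Core using (_≡_; _≢_; refl)
open import Relation.Binary.Structures using (IsDecTotalOrder)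
import Relation.Binary.Construct.Add.Supremum.Strict as AddSupStrict
import Relation.Binary.Construct.Add.Supremum.NonStrict as AddSupNonStrict
import Relation.Binary.Construct.NonStrictToStrict as ToStrict
open import Relation.Nullary.Construct.Add.Supremum using (_⁺; ⊤⁺; [_])
open import Relation.Nullary.Decidable
  using (Dec; yes; no; does; _×-dec_; _⊎-dec_; ¬?; map′)
open import Relation.Nullary.Negation using (¬_; contradiction)
open import Relation.Unary using (Pred; U)

-- Numbers.  The real numbers are one (classical) instance of this record.

record OrderedField c ℓ₁ ℓ₂ : Set (lsuc (c ⊔ ℓ₁ ⊔ ℓ₂)) where
  field
    commutativeRing : CommutativeRing c ℓ₁
  open CommutativeRing commutativeRing public
    using (Carrier; _≈_; _+_; _*_; _-_; 0#; 1#; +-rawMonoid)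
  infix 4 _≤_
  field
    _≤_             : Rel Carrier ℓ₂
    isDecTotalOrder : IsDecTotalOrder _≈_ _≤_
    +-monoʳ-≤       : ∀ z {x y} → x ≤ y → z + x ≤ z + y
    *-nonNegative   : ∀ {x y} → 0# ≤ x → 0# ≤ y → 0# ≤ x * y
    0≉1             : ¬ 0# ≈ 1#
    inverse         : ∀ x → ¬ x ≈ 0# → ∃ λ y → x * y ≈ 1#

  module Order = IsDecTotalOrder isDecTotalOrder
  open Order public using () renaming (_≟_ to _≈?_; _≤?_ to _≤?_)

  open ToStrict _≈_ _≤_ public using (_<_)

  infix 4 _<?_
  _<?_ : Decidable _<_
  _<?_ = ToStrict.<-decidable _≈_ _≤_ _≈?_ _≤?_

  fromℕ : ℕ → Carrier
  fromℕ k = k · 1# where open RawMonoidDefs +-rawMonoid using () renaming (_×_ to _·_)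

  open AddSupNonStrict _≤_ public using (_≤⁺_)
  open AddSupStrict _<_ public using (_<⁺_; <⁺-dec)

  infix 4 _<⁺?_
  _<⁺?_ : Decidable _<⁺_
  _<⁺?_ = <⁺-dec _<?_

  infixl 6 _+⁺_
  _+⁺_ : Carrier → Carrier ⁺ → Carrier ⁺
  x +⁺ [ y ] = [ x + y ]
  x +⁺ ⊤⁺    = ⊤⁺

  -- An equality test that fails whenever a side is infinite.
  finiteEqual : Carrier ⁺ → Carrier ⁺ → Bool
  finiteEqual [ x ] [ y ] = does (x ≈? y)
  finiteEqual _     _     = false

-- Road networks.  φ is only meaningful on edges.

record RoadNetwork {c ℓ₁ ℓ₂} (F : OrderedField c ℓ₁ ℓ₂) (n : ℕ) :
                   Set (lsuc 0ℓ ⊔ c ⊔ ℓ₁ ⊔ ℓ₂) where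
  open OrderedField F
  field
    Adj           : Rel (Fin n) 0ℓ
    adj?          : Decidable Adj
    adj-sym       : Symmetric Adj
    φ             : Fin n → Fin n → Carrier
    φ-sym         : ∀ {u v} → Adj u v → φ u v ≈ φ v u
    φ-nonNegative : ∀ {u v} → Adj u v → 0# ≤ φ u v

module _ {c ℓ₁ ℓ₂} {F : OrderedField c ℓ₁ ℓ₂} {n : ℕ} where
  open OrderedField F

  neighbours : RoadNetwork F n → Fin n → List (Fin n × Carrier)
  neighbours G v = map (λ u → u , φ u v) (filter (λ u → adj? u v) (allFin n))
    where open RoadNetwork G

  sameEdge? : (a b u v : Fin n) → Dec ((u ≡ a × v ≡ b) ⊎ (u ≡ b × v ≡ a))
  sameEdge? a b u v = (u ≟ a ×-dec v ≟ b) ⊎-dec (u ≟ b ×-dec v ≟ a)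

  increaseWeight : (G : RoadNetwork F n) → let open RoadNetwork G in
                   ∀ {a b} → Adj a b → (φ-new : Carrier) → φ a b < φ-new →
                   RoadNetwork F n
  increaseWeight G {a} {b} ab φ-new φ<φ-new = record
    { Adj           = Adj
    ; adj?          = adj?
    ; adj-sym       = adj-sym
    ; φ             = φ′
    ; φ-sym         = φ′-sym
    ; φ-nonNegative = φ′-nonNegative
    }
    where
    open RoadNetwork G

    φ′ : Fin n → Fin n → Carrier
    φ′ u v = if does (sameEdge? a b u v) then φ-new else φ u v

    if-cong : ∀ {P Q : Set} {x y z} (p : Dec P) (q : Dec Q) → (P → Q) → (Q → P) → x ≈ y →
              (if does p then z else x) ≈ (if does q then z else y)
    if-cong (yes _) (yes _) _ _ _   = Order.Eq.refl
    if-cong (no _)  (no _)  _ _ x≈y = x≈y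
    if-cong (yes p) (no ¬q) f _ _   = contradiction (f p) ¬q
    if-cong (no ¬p) (yes q) _ g _   = contradiction (g q) ¬p

    swapEnds : ∀ {u v} → (u ≡ a × v ≡ b) ⊎ (u ≡ b × v ≡ a) →
               (v ≡ a × u ≡ b) ⊎ (v ≡ b × u ≡ a)
    swapEnds (inj₁ (p , q)) = inj₂ (q , p)
    swapEnds (inj₂ (p , q)) = inj₁ (q , p)

    φ′-sym : ∀ {u v} → Adj u v → φ′ u v ≈ φ′ v u
    φ′-sym {u} {v} uv =
      if-cong (sameEdge? a b u v) (sameEdge? a b v u) swapEnds swapEnds (φ-sym uv)

    φ′-nonNegative : ∀ {u v} → Adj u v → 0# ≤ φ′ u v
    φ′-nonNegative {u} {v} uv with does (sameEdge? a b u v)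
    ... | true  = Order.trans (φ-nonNegative ab) (proj₁ φ<φ-new)
    ... | false = φ-nonNegative uv

  -- Paths are vertex sequences, possibly with repetitions.  A predicate S
  -- restricts them to the subgraph induced by S.

  record IsPath (G : RoadNetwork F n) (S : Pred (Fin n) 0ℓ) (s t : Fin n)
                (p : List (Fin n)) : Set where
    field
      linked : Linked (RoadNetwork.Adj G) p
      start  : head p ≡ just s
      end    : last p ≡ just t
      inside : All S p

  weight : RoadNetwork F n → List (Fin n) → Carrier
  weight G []          = 0#
  weight G (u ∷ [])    = 0#
  weight G (u ∷ v ∷ p) = RoadNetwork.φ G u v + weight G (v ∷ p)

  record IsShortestPath (G : RoadNetwork F n) (S : Pred (Fin n) 0ℓ) (s t : Fin n)
                        (p : List (Fin n)) : Set ℓ₂ where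
    field
      isPath  : IsPath G S s t p
      minimal : ∀ {q} → IsPath G S s t q → weight G p ≤ weight G q

  data IsDistance (G : RoadNetwork F n) (S : Pred (Fin n) 0ℓ) (s t : Fin n) :
                  Carrier ⁺ → Set (c ⊔ ℓ₁ ⊔ ℓ₂) where
    finite   : ∀ {p x} → IsShortestPath G S s t p → weight G p ≈ x → IsDistance G S s t [ x ]
    infinite : (∀ p → ¬ IsPath G S s t p) → IsDistance G S s t ⊤⁺

  -- Equality of P_G(s,t) and P_G′(s,t) (in the subgraphs induced by S): the same
  -- paths, of the same length.
  record SameShortestPaths (G G′ : RoadNetwork F n) (S : Pred (Fin n) 0ℓ)
                           (s t : Fin n) : Set (ℓ₁ ⊔ ℓ₂) where
    field
      samePaths  : ∀ p → IsShortestPath G S s t p ⇔ IsShortestPath G′ S s t p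
      sameLength : ∀ p q → IsShortestPath G S s t p → IsShortestPath G′ S s t q →
                   weight G p ≈ weight G′ q

-- Rooted binary trees; a missing child is the empty tree.

data BinaryTree : Set where
  ∅    : BinaryTree
  node : BinaryTree → BinaryTree → BinaryTree

data Node : BinaryTree → Set where
  root  : ∀ {l r} → Node (node l r)
  left  : ∀ {l r} → Node l → Node (node l r)
  right : ∀ {l r} → Node r → Node (node l r)

-- N ⊑ M: N is M or an ancestor of M.
infix 4 _⊑_ _⊑?_
data _⊑_ : ∀ {t} → Rel (Node t) 0ℓ where
  root  : ∀ {l r} {M : Node (node l r)} → root ⊑ M
  left  : ∀ {l r} {N M : Node l} → N ⊑ M → left {l} {r} N ⊑ left M
  right : ∀ {l r} {N M : Node r} → N ⊑ M → right {l} {r} N ⊑ right M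

_⊑?_ : ∀ {t} → Decidable (_⊑_ {t})
root    ⊑? M       = yes root
left N  ⊑? root    = no λ ()
left N  ⊑? left M  = map′ left (λ { (left p) → p }) (N ⊑? M)
left N  ⊑? right M = no λ ()
right N ⊑? root    = no λ ()
right N ⊑? left M  = no λ ()
right N ⊑? right M = map′ right (λ { (right p) → p }) (N ⊑? M)

_≟ᴺ_ : ∀ {t} → Decidable (_≡_ {A = Node t})
root    ≟ᴺ root    = yes refl
root    ≟ᴺ left M  = no λ ()
root    ≟ᴺ right M = no λ ()
left N  ≟ᴺ root    = no λ ()
left N  ≟ᴺ left M  = map′ (λ { refl → refl }) (λ { refl → refl }) (N ≟ᴺ M)
left N  ≟ᴺ right M = no λ ()
right N ≟ᴺ root    = no λ ()
right N ≟ᴺ left M  = no λ ()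
right N ≟ᴺ right M = map′ (λ { refl → refl }) (λ { refl → refl }) (N ≟ᴺ M)

-- Child N C: C is a child of N.
data Child : ∀ {t} → Rel (Node t) 0ℓ where
  rootˡ : ∀ {l₁ l₂ r} → Child {node (node l₁ l₂) r} root (left root)
  rootʳ : ∀ {l r₁ r₂} → Child {node l (node r₁ r₂)} root (right root)
  left  : ∀ {l r} {N C : Node l} → Child N C → Child {node l r} (left N) (left C)
  right : ∀ {l r} {N C : Node r} → Child N C → Child {node l r} (right N) (right C)

-- |T↓(N)|
subtreeSize : ∀ {n t} → (Fin n → Node t) → Node t → ℕ
subtreeSize {n} ℓ N = Vec.count (λ v → N ⊑? ℓ v) (Vec.allFin n)

record StableTreeHierarchy {c ℓ₁ ℓ₂} {F : OrderedField c ℓ₁ ℓ₂} {n}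
                           (G : RoadNetwork F n) : Set (c ⊔ ℓ₁ ⊔ ℓ₂) where
  open OrderedField F
  field
    tree       : BinaryTree
    ℓ          : Fin n → Node tree
    surjective : Surjective _≡_ _≡_ ℓ
    β          : Carrier
    0<β        : 0# < β
    β≤½        : β + β ≤ 1#
    balanced   : ∀ {N C} → Child N C →
                 fromℕ (subtreeSize ℓ C) ≤ (1# - β) * fromℕ (subtreeSize ℓ N)
    separating : ∀ {s t p} → IsPath G U s t p → Any (λ v → ℓ v ⊑ ℓ s × ℓ v ⊑ ℓ t) p

module _ {c ℓ₁ ℓ₂} {F : OrderedField c ℓ₁ ℓ₂} {n} {G : RoadNetwork F n}
         (T : StableTreeHierarchy G)
         {_≤ₜ_ : Rel (Fin n) 0ℓ} (≤ₜ-order : IsDecTotalOrder _≡_ _≤ₜ_) where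
  open StableTreeHierarchy T

  Precedes : Rel (Fin n) 0ℓ
  Precedes w v = (ℓ w ⊑ ℓ v × ℓ w ≢ ℓ v) ⊎ (ℓ w ≡ ℓ v × w ≤ₜ v)

  precedes? : Decidable Precedes
  precedes? w v = (ℓ w ⊑? ℓ v ×-dec ¬? (ℓ w ≟ᴺ ℓ v)) ⊎-dec (ℓ w ≟ᴺ ℓ v ×-dec w ≤ₜ? v)
    where open IsDecTotalOrder ≤ₜ-order using () renaming (_≤?_ to _≤ₜ?_)

  Anc Desc : Fin n → Pred (Fin n) 0ℓ
  Anc v w  = Precedes w v
  Desc w x = Precedes w x

  τ : Fin n → ℕ
  τ v = Vec.count (λ w → precedes? w v ×-dec ¬? (w ≟ v)) (Vec.allFin n)

-- L v i is the entry L_v[i]; entries with i > τ(v) are junk.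
Labels : ∀ {c ℓ₁ ℓ₂} → OrderedField c ℓ₁ ℓ₂ → ℕ → Set c
Labels F n = Fin n → ℕ → OrderedField.Carrier F ⁺

IsStableTreeLabelling :
  ∀ {c ℓ₁ ℓ₂} {F : OrderedField c ℓ₁ ℓ₂} {n} {G : RoadNetwork F n} →
  StableTreeHierarchy G → {_≤ₜ_ : Rel (Fin n) 0ℓ} → IsDecTotalOrder _≡_ _≤ₜ_ →
  Labels F n → Set (c ⊔ ℓ₁ ⊔ ℓ₂)
IsStableTreeLabelling {G = G} T O L =
  ∀ v i → i ℕ.≤ τ T O v → ∀ w → Anc T O v w → τ T O w ≡ i →
  IsDistance G (Desc T O w) v w (L v i)

record Interval : Set where
  constructor ⟦_,_⟧
  field
    min max : ℕ
open Interval

range : Interval → List ℕ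
range I = map (min I ℕ.+_) (upTo (suc (max I) ∸ min I))

-- An undefined interval is empty.
indices : Maybe Interval → List ℕ
indices = maybe′ range []

-- Set min to i if it is undefined, and max to j.
extend : Maybe Interval → ℕ → ℕ → Interval
extend nothing  i j = ⟦ i , j ⟧
extend (just I) i j = ⟦ min I , j ⟧

-- Runs of a priority-queue loop.  Processing an entry updates the state and
-- yields the entries to be added.  x ⊴ y says that x may be extracted while y is
-- in the queue; remaining ties are resolved arbitrarily.

data Drain {a s ℓ} {Entry : Set a} {State : Set s} (_⊴_ : Rel Entry ℓ)
           (process : Entry → State → State × List Entry) :
           List Entry → State → State → Set (a ⊔ s ⊔ ℓ) where
  empty   : ∀ {σ} → Drain _⊴_ process [] σ σ
  extract : ∀ {Q e Q′ σ σ″} → Q ↭ e ∷ Q′ → All (e ⊴_) Q′ →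
            (let σ′ , new = process e σ) →
            Drain _⊴_ process (new ++ Q′) σ′ σ″ →
            Drain _⊴_ process Q σ σ″

module Algorithm {c ℓ₁ ℓ₂} {F : OrderedField c ℓ₁ ℓ₂} {n}
                 (G G′ : RoadNetwork F n) (τ : Fin n → ℕ) where
  open OrderedField F

  setLabel : Labels F n → Fin n → ℕ → Carrier ⁺ → Labels F n
  setLabel L v i x = updateAt L v λ Lᵥ j → if j ℕ.≡ᵇ i then x else Lᵥ j

  Affected : Set
  Affected = Fin n → Maybe Interval

  record SearchEntry : Set c where
    constructor entry
    field
      dist     : Carrier
      vertex   : Fin n
      interval : Interval

  _⊴_ : Rel SearchEntry (ℓ₁ ⊔ ℓ₂)
  entry d _ I ⊴ entry d′ _ I′ = d < d′ ⊎ (d ≈ d′ × max I′ ℕ.≤ max I)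

  -- propagated is ghost state: the vertices whose neighbours were looped over.
  record SearchState : Set c where
    field
      labels     : Labels F n
      level      : Fin n → ℕ
      affected   : Affected
      propagated : List (Fin n)

  -- Step (ii): the updated labels, and [min, max] if defined.
  scan : (Δ : Carrier) (r : Fin n) (d : Carrier) (v : Fin n) → List ℕ →
         Labels F n → Labels F n × Maybe Interval
  scan Δ r d v is L₀ = foldl test (L₀ , nothing) is
    where
    test : Labels F n × Maybe Interval → ℕ → Labels F n × Maybe Interval
    test (L , m) i =
      if finiteEqual (d +⁺ L r i) (L v i)
      then (setLabel L v i (Δ +⁺ L v i) , just (extend m i i))
      else (L , m)

  visit : (Δ : Carrier) (r : Fin n) → SearchEntry → SearchState →
          SearchState × List SearchEntry
  visit Δ r (entry d v I) σ =
    if does (lo ℕ.≤? hi) then propagate (scan Δ r d v (range ⟦ lo , hi ⟧) labels) else (σ , [])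
    where
    open SearchState σ
    lo = min I ℕ.⊔ level v
    hi = max I ℕ.⊓ τ v
    level′ = updateAt level v (const (suc hi))

    propagate : Labels F n × Maybe Interval → SearchState × List SearchEntry
    propagate (L , nothing) =
      record { labels = L ; level = level′ ; affected = affected ; propagated = propagated } , []
    propagate (L , just J) =
      record { labels     = L
             ; level      = level′
             ; affected   = updateAt affected v λ A → just (extend A (min J) (max J))
             ; propagated = v ∷ propagated } ,
      map (λ (m , φₘ) → entry (d + φₘ) m J) (neighbours G v)

  RepairEntry : Set c
  RepairEntry = Carrier ⁺ × Fin n × ℕ

  _⊴ᴿ_ : Rel RepairEntry (c ⊔ ℓ₂)
  (d , _) ⊴ᴿ (d′ , _) = d ≤⁺ d′

  repairQueue : Affected → Labels F n → List RepairEntry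
  repairQueue affected L =
    concatMap (λ v →
      concatMap (λ (m , φₘ) →
        map (λ i → φₘ +⁺ L m i , v , i)
          (filterᵇ (λ i → does (i ℕ.≤? τ m) ∧ does (φₘ +⁺ L m i <⁺? L v i))
            (indices (affected v))))
        (neighbours G′ v))
      (allFin n)

  repairVisit : Affected → RepairEntry → Labels F n → Labels F n × List RepairEntry
  repairVisit affected (d , v , i) L =
    if does (d <⁺? L v i) then (L′ , new) else (L , [])
    where
    open import Data.List.Membership.DecPropositional ℕ._≟_ using (_∈?_)
    L′ = setLabel L v i d
    new = map (λ (m , φₘ) → φₘ +⁺ L′ v i , m , i)
            (filterᵇ (λ (m , φₘ) → does (i ∈? indices (affected m)) ∧
                                   does (φₘ +⁺ L′ v i <⁺? L′ m i))
              (neighbours G′ v))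

  -- Search(r, r′, φ) from labels L to labels L′, including the final Repair.
  record SearchRun (Δ : Carrier) (r r′ : Fin n) (φ : Carrier) (L L′ : Labels F n) :
                   Set (c ⊔ ℓ₁ ⊔ ℓ₂) where
    field
      final  : SearchState
    open SearchState final public
    field
      search : Drain _⊴_ (visit Δ r) (entry φ r′ ⟦ 0 , τ r ℕ.⊓ τ r′ ⟧ ∷ [])
                 (record { labels = L ; level = const 0
                         ; affected = const nothing ; propagated = [] })
                 final
      repair : Drain _⊴ᴿ_ (repairVisit affected) (repairQueue affected labels) labels L′

  record ParetoIncreaseRun (a b : Fin n) (φ-old φ-new : Carrier) (L : Labels F n) :
                           Set (c ⊔ ℓ₁ ⊔ ℓ₂) where
    field
      {L₁ L₂} : Labels F n
      first   : SearchRun (φ-new - φ-old) a b φ-old L L₁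
      second  : SearchRun (φ-new - φ-old) b a φ-old L₁ L₂

  V⁺Δ : ∀ {a b φ-old φ-new L} → ParetoIncreaseRun a b φ-old φ-new L → Pred (Fin n) 0ℓ
  V⁺Δ run v = v ∈ SearchRun.propagated first ⊎ v ∈ SearchRun.propagated second
    where open ParetoIncreaseRun run

{-# OPTIONS --safe #-}

-- Fix an index i, hence a common ancestor w of a and b, and look at the entries L_v[i] only.
-- Search(r, r′) is then Dijkstra's algorithm confined to the tight vertices, those v with
-- L_v[i] = d + L_r[i] for a walk r, r′, …, v of weight d in G[Desc(w)]; they are the vertices with
-- a shortest path to w through the edge from r′ to r.  Narrowing the intervals loses no tight
-- vertex: tightness fails for good along a walk once it fails, which covers the indices below
-- I.min, and the indices below level(v) belong to an earlier visit of v at a smaller distance,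
-- because among equal distances the larger I.max comes first.
-- The second search sees the labels left by the first search and its repair.  As φ(a, b) > 0,
-- shortest paths to a fixed w use the edge in one direction only.  If it is the direction of the
-- first search, then the repaired i-th entries obey the triangle inequality of G′, which leaves no
-- tight vertex to the second search; otherwise the i-th entries are still the distances in G.
module Submission where

open import Defs
open import Level using (0ℓ; _⊔_)
open import Algebra.Bundles using (CommutativeRing)
import Algebra.Properties.CommutativeSemigroup as CommutativeSemigroupProperties
open import Data.Bool.Base using (Bool; true; false; T; _∧_; if_then_else_)
open import Data.Bool.Properties using (T-∧)
open import Data.Fin.Base using (Fin)
open import Data.Fin.Properties using (_≟_)
open import Data.List.Base
  using (List; []; _∷_; _++_; allFin; applyUpTo; concatMap; filterᵇ; foldl; map)
import Data.List.Membership.DecPropositional as DecMembership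
open import Data.List.Membership.Propositional using (_∈_; find)
open import Data.List.Membership.Propositional.Properties
  using (∈-++⁻; ∈-allFin; ∈-concatMap⁺; ∈-concatMap⁻; ∈-map⁺; ∈-map⁻; ∈-map∘filter⁺; ∈-map∘filter⁻)
open import Data.List.Properties using (map-upTo)
open import Data.List.Relation.Binary.Permutation.Propositional using (_↭_; ↭-sym)
open import Data.List.Relation.Binary.Permutation.Propositional.Properties
  using (∈-resp-↭; Any-resp-↭)
open import Data.List.Relation.Unary.All as All using (All; []; _∷_)
open import Data.List.Relation.Unary.Any as Any using (Any; here; there)
open import Data.List.Relation.Unary.Any.Properties using (++⁺ˡ; ++⁺ʳ)
open import Data.List.Relation.Unary.Linked using ([-]; _∷_)
open import Data.Maybe.Base using (Maybe; just; nothing)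
open import Data.Nat.Base as ℕ using (ℕ; zero; suc; z≤n; s≤s; _∸_)
import Data.Nat.Properties as ℕ
open import Data.Product.Base using (_×_; _,_; proj₁; proj₂; ∃)
open import Data.Sum.Base using (_⊎_; inj₁; inj₂; [_,_]′; swap)
import Data.Vec.Base as Vec
open import Data.Vec.Functional using (updateAt)
open import Data.Vec.Functional.Properties using (updateAt-updates; updateAt-minimal)
import Data.Vec.Membership.Propositional as Vec
import Data.Vec.Membership.Propositional.Properties as Vec
import Data.Vec.Relation.Unary.All as Vecᴬ
open import Data.Vec.Relation.Unary.AllPairs using (_∷_)
import Data.Vec.Relation.Unary.Any as Vecᴱ
open import Data.Vec.Relation.Unary.Unique.Propositional using (Unique)
open import Data.Vec.Relation.Unary.Unique.Propositional.Properties using (tabulate⁺)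
open import Function.Base using (_∘_; const)
open import Function.Bundles using (_⇔_; mk⇔; module Equivalence)
open import Relation.Binary.Bundles using (Poset)
import Relation.Binary.Construct.Add.Supremum.NonStrict as AddSupNonStrict
import Relation.Binary.Construct.Add.Supremum.Strict as AddSupStrict
import Relation.Binary.Construct.NonStrictToStrict as ToStrict
open import Relation.Binary.Core using (Rel)
open import Relation.Binary.Definitions using (Decidable)
open import Relation.Binary.PropositionalEquality
  using (_≡_; _≢_; refl; sym; trans; cong; cong₂; subst; subst₂)
import Relation.Binary.Reasoning.PartialOrder
open import Relation.Binary.Structures using (IsDecTotalOrder)
open import Relation.Nullary.Construct.Add.Supremum using (_⁺; ⊤⁺; [_])
open import Relation.Nullary.Decidable
  using (Dec; yes; no; does; map′; dec-true; dec-false; ¬?; T?; _×-dec_)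
open import Relation.Nullary.Negation using (¬_; contradiction)
open import Relation.Unary as Unary using (Pred)
open Interval

-- Arithmetic with infinite labels

-- The test d + L_r[i] = L_v[i] reads labels that the search itself is changing. It still expresses
-- tightness in the labels the search began with: walk weights are positive, so r is never tight and
-- its row stays fixed, and a changed entry of v lies below level(v), where no later scan looks.
-- Soundness treats all indices together. Completeness fixes one index although the queued intervals
-- serve all of them, so its invariant has to say why an index may be missing from an interval.
-- Repair is never shown to compute the distances in G′. It suffices that its result lies between L
-- and the labels it received and that every edge is relaxed when its queue is empty. Walks may not
-- return to r because the second search has r = b: on edges avoiding b the weights of G and G′
-- agree, so the triangle inequality in G′ bounds the rest of a walk that is weighed in G.

module OrderedFieldProperties {c ℓ₁ ℓ₂} (F : OrderedField c ℓ₁ ℓ₂) where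
  open OrderedField F public
  open CommutativeRing commutativeRing public
    using (+-comm; +-assoc; +-congˡ; +-congʳ; +-identityˡ; +-identityʳ; -‿inverseˡ; -_)
  open Order public
    using (antisym; total; module Eq)
    renaming (refl to ≤-refl; trans to ≤-trans; reflexive to ≤-reflexive)
  open AddSupNonStrict _≤_ public using ([_]; _≤⊤⁺)
  open AddSupStrict _<_ public using ([_]; [_]<⊤⁺)

  open CommutativeSemigroupProperties
    (CommutativeRing.+-commutativeSemigroup commutativeRing) public using (x∙yz≈y∙xz)

  poset : Poset c ℓ₁ ℓ₂
  poset = record { isPartialOrder = Order.isPartialOrder }

  module ≤-Reasoning = Relation.Binary.Reasoning.PartialOrder poset

  +-monoˡ-≤ : ∀ z {x y} → x ≤ y → x + z ≤ y + z
  +-monoˡ-≤ z {x} {y} x≤y = begin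
    x + z ≈⟨ +-comm x z ⟩
    z + x ≤⟨ +-monoʳ-≤ z x≤y ⟩
    z + y ≈⟨ +-comm z y ⟩
    y + z ∎
    where open ≤-Reasoning

  +-mono-≤ : ∀ {x y u v} → x ≤ y → u ≤ v → x + u ≤ y + v
  +-mono-≤ {y = y} {u} x≤y u≤v = ≤-trans (+-monoˡ-≤ u x≤y) (+-monoʳ-≤ y u≤v)

  -x+[x+y]≈y : ∀ x y → - x + (x + y) ≈ y
  -x+[x+y]≈y x y = begin-equality
    - x + (x + y) ≈⟨ +-assoc (- x) x y ⟨
    - x + x + y   ≈⟨ +-congʳ (-‿inverseˡ x) ⟩
    0# + y        ≈⟨ +-identityˡ y ⟩
    y             ∎
    where open ≤-Reasoning

  +-cancelˡ-≤ : ∀ z {x y} → z + x ≤ z + y → x ≤ y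
  +-cancelˡ-≤ z {x} {y} zx≤zy = begin
    x             ≈⟨ -x+[x+y]≈y z x ⟨
    - z + (z + x) ≤⟨ +-monoʳ-≤ (- z) zx≤zy ⟩
    - z + (z + y) ≈⟨ -x+[x+y]≈y z y ⟩
    y             ∎
    where open ≤-Reasoning

  +-cancelʳ-≤ : ∀ z {x y} → x + z ≤ y + z → x ≤ y
  +-cancelʳ-≤ z {x} {y} xz≤yz = +-cancelˡ-≤ z (begin
    z + x ≈⟨ +-comm z x ⟩
    x + z ≤⟨ xz≤yz ⟩
    y + z ≈⟨ +-comm y z ⟩
    z + y ∎)
    where open ≤-Reasoning

  x≤x+y : ∀ {x y} → 0# ≤ y → x ≤ x + y
  x≤x+y {x} {y} 0≤y = begin
    x      ≈⟨ +-identityʳ x ⟨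
    x + 0# ≤⟨ +-monoʳ-≤ x 0≤y ⟩
    x + y  ∎
    where open ≤-Reasoning

  x≤y+x : ∀ {x y} → 0# ≤ y → x ≤ y + x
  x≤y+x {x} {y} 0≤y = ≤-trans (x≤x+y 0≤y) (≤-reflexive (+-comm x y))

  +-mono-<-≤ : ∀ {x y u v} → x < y → u ≤ v → x + u < y + v
  +-mono-<-≤ {x} {y} {u} {v} (x≤y , x≉y) u≤v =
    +-mono-≤ x≤y u≤v ,
    λ eq → x≉y (antisym x≤y (+-cancelʳ-≤ u (≤-trans (+-monoʳ-≤ y u≤v) (≤-reflexive (Eq.sym eq)))))

  +-mono-≤-< : ∀ {x y u v} → x ≤ y → u < v → x + u < y + v
  +-mono-≤-< {x} {y} {u} {v} x≤y u<v =
    let p , q = +-mono-<-≤ u<v x≤y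
    in +-mono-≤ x≤y (proj₁ u<v) ,
       λ eq → q (Eq.trans (+-comm u x) (Eq.trans eq (+-comm y v)))

  <⇒≱ : ∀ {x y} → x < y → ¬ (y ≤ x)
  <⇒≱ = ToStrict.<⇒≱ _≈_ _≤_ antisym

  <-≤-trans : ∀ {x y z} → x < y → y ≤ z → x < z
  <-≤-trans x<y y≤z = ≤-trans (proj₁ x<y) y≤z , λ x≈z →
      <⇒≱ x<y (≤-trans y≤z (≤-reflexive (Eq.sym x≈z)))

  ≤-<-trans : ∀ {x y z} → x ≤ y → y < z → x < z
  ≤-<-trans x≤y y<z = ≤-trans x≤y (proj₁ y<z) , λ x≈z →
      <⇒≱ y<z (≤-trans (≤-reflexive (Eq.sym x≈z)) x≤y)

  0<y⇒y+x≰x : ∀ {x y} → 0# < y → ¬ (y + x ≤ x)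
  0<y⇒y+x≰x {x} {y} 0<y yx≤x =
    <⇒≱ 0<y (+-cancelʳ-≤ x (≤-trans yx≤x (≤-reflexive (Eq.sym (+-identityˡ x)))))

  ≤⁺-refl : ∀ {x} → x ≤⁺ x
  ≤⁺-refl {[ x ]} = [ ≤-refl ]
  ≤⁺-refl {⊤⁺}    = ⊤⁺ ≤⊤⁺

  ≤⁺-trans : ∀ {x y z} → x ≤⁺ y → y ≤⁺ z → x ≤⁺ z
  ≤⁺-trans = AddSupNonStrict.≤⁺-trans _≤_ ≤-trans

  ≤⁺-reflexive : ∀ {x y} → x ≡ y → x ≤⁺ y
  ≤⁺-reflexive refl = ≤⁺-refl

  <⁺⇒≤⁺ : ∀ {x y} → x <⁺ y → x ≤⁺ y
  <⁺⇒≤⁺ [ x<y ]   = [ proj₁ x<y ]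
  <⁺⇒≤⁺ [ x ]<⊤⁺ = [ x ] ≤⊤⁺

  ≮⁺⇒≥⁺ : ∀ {x y} → ¬ (x <⁺ y) → y ≤⁺ x
  ≮⁺⇒≥⁺ {[ x ]} {[ y ]} x≮y =
    [ ToStrict.≮⇒≥ _≈_ _≤_ Eq.sym _≈?_ ≤-reflexive total (x≮y ∘ [_]) ]
  ≮⁺⇒≥⁺ {[ x ]} {⊤⁺}    x≮y = contradiction [ x ]<⊤⁺ x≮y
  ≮⁺⇒≥⁺ {⊤⁺}    {y}     x≮y = y ≤⊤⁺

  +⁺-mono-≤⁺ : ∀ {x y u v} → x ≤ y → u ≤⁺ v → x +⁺ u ≤⁺ y +⁺ v
  +⁺-mono-≤⁺ x≤y [ u≤v ]   = [ +-mono-≤ x≤y u≤v ]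
  +⁺-mono-≤⁺ x≤y (u ≤⊤⁺) = _ ≤⊤⁺

  ≤⁺-+⁺ : ∀ {x y u v w} → u ≤⁺ x +⁺ v → v ≤⁺ y +⁺ w → u ≤⁺ (y + x) +⁺ w
  ≤⁺-+⁺ {x} {y} {w = [ w ]} u≤xv v≤yw = ≤⁺-trans u≤xv (≤⁺-trans (+⁺-mono-≤⁺ ≤-refl v≤yw) [ (begin
    x + (y + w) ≈⟨ x∙yz≈y∙xz x y w ⟩
    y + (x + w) ≈⟨ +-assoc y x w ⟨
    y + x + w   ∎) ])
    where open ≤-Reasoning
  ≤⁺-+⁺ {w = ⊤⁺} _ _ = _ ≤⊤⁺

  ≤⁺-+⁺-shift : ∀ {x y z u v w} → u ≤⁺ x +⁺ v → z +⁺ v ≤⁺ y +⁺ w → z +⁺ u ≤⁺ (y + x) +⁺ w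
  ≤⁺-+⁺-shift {x} {y} {z} {v = [ v ]} {w = [ w ]} u≤xv [ zv≤yw ] =
    ≤⁺-trans (+⁺-mono-≤⁺ ≤-refl u≤xv) [ (begin
      z + (x + v) ≈⟨ x∙yz≈y∙xz z x v ⟩
      x + (z + v) ≤⟨ +-monoʳ-≤ x zv≤yw ⟩
      x + (y + w) ≈⟨ x∙yz≈y∙xz x y w ⟩
      y + (x + w) ≈⟨ +-assoc y x w ⟨
      y + x + w   ∎) ]
    where open ≤-Reasoning
  ≤⁺-+⁺-shift {w = ⊤⁺} _ _ = _ ≤⊤⁺

  infix 4 _≐_
  -- Mirrors `finiteEqual`: infinity is not even equal to itself. Matching on a proof forces the
  -- labels in the equation to be finite, which is what permits cancellation.
  data _≐_ : Rel (Carrier ⁺) (c ⊔ ℓ₁) where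
    [_] : ∀ {x y} → x ≈ y → [ x ] ≐ [ y ]

  infix 4 _≐?_
  _≐?_ : Decidable _≐_
  [ x ] ≐? [ y ] = map′ [_] (λ { [ x≈y ] → x≈y }) (x ≈? y)
  [ x ] ≐? ⊤⁺    = no λ ()
  ⊤⁺    ≐? y     = no λ ()

  finiteEqual-does : ∀ x y → finiteEqual x y ≡ does (x ≐? y)
  finiteEqual-does [ x ] [ y ] = refl
  finiteEqual-does [ x ] ⊤⁺    = refl
  finiteEqual-does ⊤⁺    y     = refl

  ≐⇒≤⁺ : ∀ {x y} → x ≐ y → x ≤⁺ y
  ≐⇒≤⁺ [ x≈y ] = [ ≤-reflexive x≈y ]

  ≐-respˡ : ∀ {x y u v} → x ≈ y → x +⁺ u ≐ v → y +⁺ u ≐ v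
  ≐-respˡ {u = [ u ]} x≈y [ eq ] = [ Eq.trans (+-congʳ (Eq.sym x≈y)) eq ]

  0<x⇒x+u≭u : ∀ {x u} → 0# < x → ¬ x +⁺ u ≐ u
  0<x⇒x+u≭u {u = [ u ]} 0<x [ eq ] = 0<y⇒y+x≰x 0<x (≤-reflexive eq)

  ≐-cancel-≤ : ∀ {x y u v} → x +⁺ u ≐ v → v ≤⁺ y +⁺ u → x ≤ y
  ≐-cancel-≤ {u = [ u ]} [ eq ] [ le ] = +-cancelʳ-≤ u (≤-trans (≤-reflexive eq) le)

  -- Tightness passes backwards along a walk: if the bound on `v` were strict, adding `y` would push
  -- `w` strictly below its own value.
  ≐-pred : ∀ {x y u v w} → (x + y) +⁺ u ≐ w → w ≤⁺ y +⁺ v → v ≤⁺ x +⁺ u → x +⁺ u ≐ v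
  ≐-pred {x} {y} {[ u ]} {[ v ]} {[ w ]} [ eq ] [ w≤yv ] [ v≤xu ] = [ antisym (+-cancelˡ-≤ y (begin
    y + (x + u) ≈⟨ x∙yz≈y∙xz y x u ⟩
    x + (y + u) ≈⟨ +-assoc x y u ⟨
    x + y + u   ≈⟨ eq ⟩
    w           ≤⟨ w≤yv ⟩
    y + v       ∎)) v≤xu ]
    where open ≤-Reasoning

  -- Cancels the weight `x` of a whole walk: summed triangle inequalities bound `y +⁺ v`, tightness
  -- evaluates `v`, and a statement about the first edge alone remains.
  ≐-shift : ∀ {x y u v w} → x +⁺ u ≐ v → y +⁺ v ≤⁺ x +⁺ w → y +⁺ u ≤⁺ w
  ≐-shift {x} {y} {[ u ]} {[ v ]} {[ w ]} [ eq ] [ yv≤xw ] = [ +-cancelˡ-≤ x (begin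
    x + (y + u) ≈⟨ x∙yz≈y∙xz x y u ⟩
    y + (x + u) ≈⟨ +-congˡ eq ⟩
    y + v       ≤⟨ yv≤xw ⟩
    x + w       ∎) ]
    where open ≤-Reasoning
  ≐-shift {w = ⊤⁺} _ _ = _ ≤⊤⁺

  -- The first premise supplies the finiteness of `u`, without which two inequalities would not give
  -- `≐`.
  ≐-antisym : ∀ {x y u v w} → x +⁺ u ≐ v → y +⁺ u ≤⁺ w → w ≤⁺ y +⁺ u → y +⁺ u ≐ w
  ≐-antisym {u = [ u ]} _ [ yu≤w ] [ w≤yu ] = [ antisym yu≤w w≤yu ]

  -- Crossing the edge and coming back would cost nothing, against its positive weight. This is what
  -- excludes using the edge in both directions for one ancestor.
  ≐-asym : ∀ {x u v} → 0# < x → x +⁺ u ≐ v → ¬ x +⁺ v ≤⁺ u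
  ≐-asym {x} {[ u ]} {[ v ]} 0<x [ eq ] [ xv≤u ] = 0<y⇒y+x≰x 0<x (begin
    x + u ≈⟨ eq ⟩
    v     ≤⟨ x≤y+x (proj₁ 0<x) ⟩
    x + v ≤⟨ xv≤u ⟩
    u     ∎)
    where open ≤-Reasoning

  +⁺-≐-resp-≤⁺ : ∀ {x u u′ v v′} → u ≤⁺ u′ → u′ ≤⁺ u → v ≤⁺ v′ → v′ ≤⁺ v →
              x +⁺ u ≐ v → x +⁺ u′ ≐ v′
  +⁺-≐-resp-≤⁺ [ u≤u′ ] [ u′≤u ] [ v≤v′ ] [ v′≤v ] [ eq ] =
    [ Eq.trans (+-congˡ (antisym u′≤u u≤u′)) (Eq.trans eq (antisym v≤v′ v′≤v)) ]

  ≐-first : ∀ {x y u v} → [ y ] ≐ u → [ x + y ] ≐ v → x +⁺ u ≐ v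
  ≐-first [ y≈u ] [ x+y≈v ] = [ Eq.trans (+-congˡ (Eq.sym y≈u)) x+y≈v ]

  ≐-next : ∀ {x y z u v w} → x +⁺ u ≐ v → [ z ] ≐ v → [ y + z ] ≐ w → (x + y) +⁺ u ≐ w
  ≐-next {x} {y} {z} {[ u ]} {[ v ]} {[ w ]} [ x+u≈v ] [ z≈v ] [ y+z≈w ] = [ (begin-equality
    x + y + u   ≈⟨ +-assoc x y u ⟩
    x + (y + u) ≈⟨ x∙yz≈y∙xz x y u ⟩
    y + (x + u) ≈⟨ +-congˡ x+u≈v ⟩
    y + v       ≈⟨ +-congˡ z≈v ⟨
    y + z       ≈⟨ y+z≈w ⟩
    w           ∎) ]
    where open ≤-Reasoning

  ≐-respˡ-≈ : ∀ {x y u} → x ≈ y → [ x ] ≐ u → [ y ] ≐ u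
  ≐-respˡ-≈ x≈y [ x≈u ] = [ Eq.trans (Eq.sym x≈y) x≈u ]

  ≐-resp-≤⁺ : ∀ {x u v} → u ≤⁺ v → v ≤⁺ u → [ x ] ≐ u → [ x ] ≐ v
  ≐-resp-≤⁺ [ u≤v ] [ v≤u ] [ x≈u ] = [ Eq.trans x≈u (antisym u≤v v≤u) ]

  x≤y⇒0≤y-x : ∀ {x y} → x ≤ y → 0# ≤ y - x
  x≤y⇒0≤y-x {x} {y} x≤y = +-cancelˡ-≤ x (begin
    x + 0#      ≈⟨ +-identityʳ x ⟩
    x           ≤⟨ x≤y ⟩
    y           ≈⟨ -x+[x+y]≈y x y ⟨
    - x + (x + y) ≈⟨ x∙yz≈y∙xz (- x) x y ⟩
    x + (- x + y) ≈⟨ +-congˡ (+-comm (- x) y) ⟩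
    x + (y - x) ∎)
    where open ≤-Reasoning

  x≤⁺y+⁺x : ∀ {x y} → 0# ≤ y → x ≤⁺ y +⁺ x
  x≤⁺y+⁺x {[ x ]} 0≤y = [ x≤y+x 0≤y ]
  x≤⁺y+⁺x {⊤⁺}    0≤y = ⊤⁺ ≤⊤⁺

-- Queues and intervals

drain-invariant :
  ∀ {a s ℓ p} {Entry : Set a} {State : Set s} {_⊴_ : Rel Entry ℓ}
    {process : Entry → State → State × List Entry}
    (P : List Entry → State → Set p) →
  (∀ {Q Q′ σ} → Q ↭ Q′ → P Q σ → P Q′ σ) →
  (∀ {e Q σ} → All (e ⊴_) Q → P (e ∷ Q) σ → (let σ′ , new = process e σ) → P (new ++ Q) σ′) →
  ∀ {Q σ σ′} → Drain _⊴_ process Q σ σ′ → P Q σ → P [] σ′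
drain-invariant P resp step empty pQ = pQ
drain-invariant P resp step (extract Q↭ e⊴ rest) pQ =
  drain-invariant P resp step rest (step e⊴ (resp Q↭ pQ))

-- Recursion on the first element, in place of `map` over `upTo`, lets the fold in `scan` be
-- followed by induction with the current index in view.
enumerate : ℕ → ℕ → List ℕ
enumerate k zero    = []
enumerate k (suc c) = k ∷ enumerate (suc k) c

applyUpTo-enumerate : ∀ (f : ℕ → ℕ) k c → (∀ j → f j ≡ k ℕ.+ j) → applyUpTo f c ≡ enumerate k c
applyUpTo-enumerate f k zero    eq = refl
applyUpTo-enumerate f k (suc c) eq rewrite eq 0 | ℕ.+-identityʳ k =
  cong (k ∷_) (applyUpTo-enumerate (f ∘ suc) (suc k) c λ j → trans (eq (suc j)) (ℕ.+-suc k j))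

range-enumerate : ∀ I → range I ≡ enumerate (min I) (suc (max I) ∸ min I)
range-enumerate I = trans (map-upTo _ _) (applyUpTo-enumerate _ _ _ λ _ → refl)

∈-enumerate⁻ : ∀ {j} k c → j ∈ enumerate k c → k ℕ.≤ j × j ℕ.< k ℕ.+ c
∈-enumerate⁻ k (suc c) (here refl) = ℕ.≤-refl , ℕ.m<m+n k ℕ.z<s
∈-enumerate⁻ k (suc c) (there j∈) =
  let k<j , j<k+c = ∈-enumerate⁻ (suc k) c j∈
  in ℕ.<⇒≤ k<j , ℕ.<-≤-trans j<k+c (ℕ.≤-reflexive (sym (ℕ.+-suc k c)))

∈-enumerate⁺ : ∀ {j} k c → k ℕ.≤ j → j ℕ.< k ℕ.+ c → j ∈ enumerate k c
∈-enumerate⁺ {j} k zero k≤j j<k = contradiction (ℕ.<-≤-trans j<k (ℕ.≤-reflexive (ℕ.+-identityʳ k)))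
    (ℕ.≤⇒≯ k≤j)
∈-enumerate⁺ {j} k (suc c) k≤j j<k with k ℕ.≟ j
... | yes refl = here refl
... | no k≢j   = there (∈-enumerate⁺ (suc k) c (ℕ.≤∧≢⇒< k≤j k≢j)
                   (ℕ.<-≤-trans j<k (ℕ.≤-reflexive (ℕ.+-suc k c))))

_∈ᴵ_ : ℕ → Interval → Set
j ∈ᴵ I = min I ℕ.≤ j × j ℕ.≤ max I

∈-range⁻ : ∀ {j} I → j ∈ range I → j ∈ᴵ I
∈-range⁻ {j} I j∈ with min I ℕ.≤? suc (max I)
... | yes min≤ = let lo≤j , j< = ∈-enumerate⁻ (min I) _ (subst (j ∈_) (range-enumerate I) j∈)
                 in lo≤j , ℕ.s≤s⁻¹ (ℕ.<-≤-trans j< (ℕ.≤-reflexive (ℕ.m+[n∸m]≡n min≤)))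
... | no min≰ with subst (j ∈_)
    (trans (range-enumerate I) (cong (enumerate (min I)) (ℕ.m≤n⇒m∸n≡0 (ℕ.≰⇒≥ min≰)))) j∈
...   | ()

∈-range⁺ : ∀ {j} I → j ∈ᴵ I → j ∈ range I
∈-range⁺ {j} I (lo≤j , j≤hi) = subst (j ∈_) (sym (range-enumerate I))
  (∈-enumerate⁺ (min I) _ lo≤j (ℕ.<-≤-trans (ℕ.s≤s j≤hi)
    (ℕ.≤-reflexive (sym (ℕ.m+[n∸m]≡n (ℕ.m≤n⇒m≤1+n (ℕ.≤-trans lo≤j j≤hi)))))))

module _ {c ℓ₁ ℓ₂} {F : OrderedField c ℓ₁ ℓ₂} {n : ℕ} (G : RoadNetwork F n) where
  open OrderedField F
  open RoadNetwork G

  ∈-neighbours⁺ : ∀ {m v} → Adj m v → (m , φ m v) ∈ neighbours G v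
  ∈-neighbours⁺ {m} {v} mv = ∈-map∘filter⁺ (λ u → u , φ u v) (λ u → adj? u v) {xs = allFin n}
      (m , ∈-allFin m , refl , mv)

  ∈-neighbours⁻ : ∀ {m v x} → (m , x) ∈ neighbours G v → Adj m v × x ≡ φ m v
  ∈-neighbours⁻ {v = v} m∈ with ∈-map∘filter⁻ (λ u → u , φ u v) (λ u → adj? u v) {xs = allFin n} m∈
  ... | m , _ , refl , mv = mv , refl

-- Visiting a queue entry

module VisitProperties {c ℓ₁ ℓ₂} {F : OrderedField c ℓ₁ ℓ₂} {n : ℕ}
                       (G G′ : RoadNetwork F n) (τ : Fin n → ℕ) where
  open OrderedFieldProperties F
  open Algorithm G G′ τ
  open RoadNetwork G

  setLabel-updates : ∀ L v i x → setLabel L v i x v i ≡ x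
  setLabel-updates L v i x = trans
    (cong (λ f → f i) (updateAt-updates v L))
    (cong (if_then x else L v i) (dec-true (i ℕ.≟ i) refl))

  setLabel-minimal : ∀ L v i x u j → ¬ (u ≡ v × j ≡ i) → setLabel L v i x u j ≡ L u j
  setLabel-minimal L v i x u j ≢vi with u ≟ v
  ... | no u≢v = cong (λ f → f j) (updateAt-minimal u v L u≢v)
  ... | yes refl = trans
    (cong (λ f → f j) (updateAt-updates v L))
    (cong (if_then x else L v j) (dec-false (j ℕ.≟ i) (λ j≡i → ≢vi (refl , j≡i))))

  module _ (Δ : Carrier) (r : Fin n) (d : Carrier) (v : Fin n) (L₀ : Labels F n) where

    Hit : ℕ → Set (c ⊔ ℓ₁)
    Hit i = d +⁺ L₀ r i ≐ L₀ v i

    -- `J` is the hull of the hits and may contain indices that fail the test; `min-hit` is the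
    -- index that later justifies the visit.
    record Extremes (lo k : ℕ) (J : Interval) : Set (c ⊔ ℓ₁) where
      field
        lo≤min  : lo ℕ.≤ min J
        min≤max : min J ℕ.≤ max J
        max<k   : max J ℕ.< k
        min-hit : Hit (min J)
        hits    : ∀ {i} → lo ℕ.≤ i → i ℕ.< k → Hit i → i ∈ᴵ J

    -- The state of the scan once the indices from lo to k - 1 have been tested.
    record Scanned (lo k : ℕ) (L : Labels F n) (m : Maybe Interval) : Set (c ⊔ ℓ₁) where
      field
        unchanged : ∀ u i → ¬ (u ≡ v × lo ℕ.≤ i × i ℕ.< k × Hit i) → L u i ≡ L₀ u i
        increased : ∀ {i} → lo ℕ.≤ i → i ℕ.< k → Hit i → L v i ≡ Δ +⁺ L₀ v i
        none      : m ≡ nothing → ∀ {i} → lo ℕ.≤ i → i ℕ.< k → ¬ Hit i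
        some      : ∀ {J} → m ≡ just J → Extremes lo k J

    -- The local function of scan, which cannot be named from here: scan is definitionally the
    -- fold of this copy.
    test : Labels F n × Maybe Interval → ℕ → Labels F n × Maybe Interval
    test (L , m) i =
      if finiteEqual (d +⁺ L r i) (L v i)
      then (setLabel L v i (Δ +⁺ L v i) , just (extend m i i))
      else (L , m)

    -- The test at `k` reads only entries with index `k`, and earlier tests wrote only below `k`; so
    -- it sees `L₀`, even when `v` is `r`.
    test-scanned : ∀ {lo k L m} → lo ℕ.≤ k → Scanned lo k L m →
                   let L′ , m′ = test (L , m) k in Scanned lo (suc k) L′ m′
    test-scanned {lo} {k} {L} {m} lo≤k S
      rewrite finiteEqual-does (d +⁺ L r k) (L v k)
            | Scanned.unchanged S r k (λ (_ , _ , k<k , _) → ℕ.<-irrefl refl k<k)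
            | Scanned.unchanged S v k (λ (_ , _ , k<k , _) → ℕ.<-irrefl refl k<k)
      with d +⁺ L₀ r k ≐? L₀ v k
    ... | no ¬hit = record
      { unchanged = λ u i ¬p → unchanged u i λ (p , q , i<k , h) → ¬p (p , q , ℕ.m<n⇒m<1+n i<k , h)
      ; increased = λ lo≤i i<1+k h → case-< (ℕ.m<1+n⇒m<n∨m≡n i<1+k) h (λ q → increased lo≤i q h)
      ; none = λ m≡ lo≤i i<1+k h → case-< (ℕ.m<1+n⇒m<n∨m≡n i<1+k) h (λ q → none m≡ lo≤i q h)
      ; some = λ m≡ → let open Extremes (some m≡) in record
        { lo≤min = lo≤min ; min≤max = min≤max ; max<k = ℕ.m<n⇒m<1+n max<k ; min-hit = min-hit
        ; hits = λ lo≤i i<1+k h → case-< (ℕ.m<1+n⇒m<n∨m≡n i<1+k) h (λ q → hits lo≤i q h) }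
      }
      where
      open Scanned S
      case-< : ∀ {a} {A : Set a} {i} → i ℕ.< k ⊎ i ≡ k → Hit i → (i ℕ.< k → A) → A
      case-< (inj₁ i<k)  _ f = f i<k
      case-< (inj₂ refl) h _ = contradiction h ¬hit
    ... | yes hit = record
      { unchanged = λ u i ¬p → trans
          (setLabel-minimal L v k _ u i λ { (refl , refl) → ¬p (refl , lo≤k , ℕ.≤-refl , hit) })
          (unchanged u i λ (p , q , i<k , h) → ¬p (p , q , ℕ.m<n⇒m<1+n i<k , h))
      ; increased = increased′
      ; none = λ ()
      ; some = λ { refl → extremes m refl }
      }
      where
      open Scanned S
      increased′ : ∀ {i} → lo ℕ.≤ i → i ℕ.< suc k → Hit i →
                   setLabel L v k (Δ +⁺ L₀ v k) v i ≡ Δ +⁺ L₀ v i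
      increased′ lo≤i i<1+k h with ℕ.m<1+n⇒m<n∨m≡n i<1+k
      ... | inj₁ q    = trans (setLabel-minimal L v k _ v _ λ { (_ , refl) → ℕ.<-irrefl refl q })
                              (increased lo≤i q h)
      ... | inj₂ refl = setLabel-updates L v k _
      extremes : ∀ m′ → m ≡ m′ → Extremes lo (suc k) (extend m′ k k)
      extremes nothing m≡ = record
        { lo≤min = lo≤k ; min≤max = ℕ.≤-refl ; max<k = ℕ.≤-refl ; min-hit = hit
        ; hits = hits }
        where
        hits : ∀ {i} → lo ℕ.≤ i → i ℕ.< suc k → Hit i → i ∈ᴵ ⟦ k , k ⟧
        hits lo≤i i<1+k h with ℕ.m<1+n⇒m<n∨m≡n i<1+k
        ... | inj₁ q    = contradiction h (none m≡ lo≤i q)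
        ... | inj₂ refl = ℕ.≤-refl , ℕ.≤-refl
      extremes (just J) m≡ = record
        { lo≤min = E.lo≤min ; min≤max = ℕ.≤-trans E.min≤max (ℕ.<⇒≤ E.max<k) ; max<k = ℕ.≤-refl
        ; min-hit = E.min-hit ; hits = hits }
        where
        module E = Extremes (some m≡)
        hits : ∀ {i} → lo ℕ.≤ i → i ℕ.< suc k → Hit i → i ∈ᴵ ⟦ min J , k ⟧
        hits lo≤i i<1+k h with ℕ.m<1+n⇒m<n∨m≡n i<1+k
        ... | inj₁ q    = proj₁ (E.hits lo≤i q h) , ℕ.<⇒≤ q
        ... | inj₂ refl = ℕ.≤-trans E.min≤max (ℕ.<⇒≤ E.max<k) , ℕ.≤-refl

    foldl-scanned : ∀ {lo} k c {L m} → lo ℕ.≤ k → Scanned lo k L m →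
                    let L′ , m′ = foldl test (L , m) (enumerate k c) in Scanned lo (k ℕ.+ c) L′ m′
    foldl-scanned {lo} k zero    {L} {m} lo≤k S =
        subst (λ e → Scanned lo e L m) (sym (ℕ.+-identityʳ k)) S
    foldl-scanned {lo} k (suc c) {L} {m} lo≤k S =
      subst (λ e → Scanned lo e (proj₁ s) (proj₂ s)) (sym (ℕ.+-suc k c))
        (foldl-scanned (suc k) c (ℕ.m≤n⇒m≤1+n lo≤k) (test-scanned lo≤k S))
      where s = foldl test (L , m) (enumerate k (suc c))

    scan-scanned : ∀ {lo hi} → lo ℕ.≤ hi →
                   let L′ , m′ = scan Δ r d v (range ⟦ lo , hi ⟧) L₀ in Scanned lo (suc hi) L′ m′
    scan-scanned {lo} {hi} lo≤hi =
      subst (λ is → let L′ , m′ = foldl test (L₀ , nothing) is in Scanned lo (suc hi) L′ m′)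
        (sym (range-enumerate ⟦ lo , hi ⟧))
        (subst (λ e → Scanned lo e (proj₁ s) (proj₂ s)) (ℕ.m+[n∸m]≡n (ℕ.m≤n⇒m≤1+n lo≤hi))
          (foldl-scanned lo (suc hi ∸ lo) {m = nothing} ℕ.≤-refl record
            { unchanged = λ _ _ _ → refl
            ; increased = λ lo≤i i<lo → contradiction lo≤i (ℕ.<⇒≱ i<lo)
            ; none      = λ _ lo≤i i<lo → contradiction lo≤i (ℕ.<⇒≱ i<lo)
            ; some      = λ ()
            }))
      where s = foldl test (L₀ , nothing) (enumerate lo (suc hi ∸ lo))

  -- A view of `visit`, split by emptiness of the narrowed interval and by the result of the scan,
  -- so that both invariants are proved by matching on the outcome.
  data Visited (Δ : Carrier) (r : Fin n) (d : Carrier) (v : Fin n) (I : Interval)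
               (σ : SearchState) : SearchState × List SearchEntry → Set (c ⊔ ℓ₁) where
    skip : max I ℕ.⊓ τ v ℕ.< min I ℕ.⊔ SearchState.level σ v → Visited Δ r d v I σ (σ , [])
    miss : (let open SearchState σ ; lo = min I ℕ.⊔ level v ; hi = max I ℕ.⊓ τ v) →
           lo ℕ.≤ hi → ∀ {L} → Scanned Δ r d v labels lo (suc hi) L nothing →
           Visited Δ r d v I σ
             (record σ { labels = L ; level = updateAt level v (const (suc hi)) } , [])
    hit  : (let open SearchState σ ; lo = min I ℕ.⊔ level v ; hi = max I ℕ.⊓ τ v) →
           lo ℕ.≤ hi → ∀ {L J} → Scanned Δ r d v labels lo (suc hi) L (just J) →
           Visited Δ r d v I σ
             (record σ
                { labels     = L
                ; level      = updateAt level v (const (suc hi))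
                ; affected   = updateAt affected v λ A → just (extend A (min J) (max J))
                ; propagated = v ∷ propagated } ,
              map (λ (m , φₘ) → entry (d + φₘ) m J) (neighbours G v))

  visited : ∀ Δ r d v I σ → Visited Δ r d v I σ (visit Δ r (entry d v I) σ)
  visited Δ r d v I σ
    with min I ℕ.⊔ SearchState.level σ v ℕ.≤ᵇ max I ℕ.⊓ τ v in lo≤ᵇhi
  ... | false = skip (ℕ.≰⇒> λ lo≤hi → subst T lo≤ᵇhi (ℕ.≤⇒≤ᵇ lo≤hi))
  ... | true
    with scan Δ r d v (range ⟦ min I ℕ.⊔ SearchState.level σ v , max I ℕ.⊓ τ v ⟧)
        (SearchState.labels σ)
       | scan-scanned Δ r d v (SearchState.labels σ) {min I ℕ.⊔ SearchState.level σ v}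
           {max I ℕ.⊓ τ v} (ℕ.≤ᵇ⇒≤ _ _ (subst T (sym lo≤ᵇhi) _))
  ... | _ , nothing | S = miss (ℕ.≤ᵇ⇒≤ _ _ (subst T (sym lo≤ᵇhi) _)) S
  ... | _ , just J  | S = hit (ℕ.≤ᵇ⇒≤ _ _ (subst T (sym lo≤ᵇhi) _)) S

-- Search

module SearchProperties {c ℓ₁ ℓ₂} {F : OrderedField c ℓ₁ ℓ₂} {n : ℕ}
                        (G G′ : RoadNetwork F n) (τ : Fin n → ℕ)
                        (Δ : OrderedField.Carrier F) (r r′ : Fin n) (φ₀ : OrderedField.Carrier F)
                        (0<φ₀ : OrderedField._<_ F (OrderedField.0# F) φ₀) (M : Labels F n) where
  open OrderedFieldProperties F
  open Algorithm G G′ τ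
  open SearchEntry
  open SearchState
  open VisitProperties G G′ τ
  open RoadNetwork G

  -- Walk i d v: a walk r, r′, …, v of weight d through vertices with an index i, that
  -- does not return to r before its end.
  data Walk (i : ℕ) : Carrier → Fin n → Set c where
    start : i ℕ.≤ τ r → i ℕ.≤ τ r′ → Walk i φ₀ r′
    step  : ∀ {d u m} → Walk i d u → u ≢ r → Adj m u → i ℕ.≤ τ m → Walk i (d + φ m u) m

  0<walk : ∀ {i d v} → Walk i d v → 0# < d
  0<walk (start _ _)       = 0<φ₀
  0<walk (step w _ mu _) = <-≤-trans (0<walk w) (x≤x+y (φ-nonNegative mu))

  walk-indexʳ : ∀ {i d v} → Walk i d v → i ℕ.≤ τ r
  walk-indexʳ (start i≤r _)  = i≤r
  walk-indexʳ (step w _ _ _) = walk-indexʳ w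

  walk-indexʳ′ : ∀ {i d v} → Walk i d v → i ℕ.≤ τ r′
  walk-indexʳ′ (start _ i≤r′) = i≤r′
  walk-indexʳ′ (step w _ _ _) = walk-indexʳ′ w

  walk-index : ∀ {i d v} → Walk i d v → i ℕ.≤ τ v
  walk-index (start _ i≤r′)   = i≤r′
  walk-index (step _ _ _ i≤m) = i≤m

  -- The triangle inequality summed over the edges after the first. None of them touches `r`, so it
  -- is asked for only there, which leaves room for a raised weight on the edge at `r`.
  walk-shift : ∀ {i} →
    (∀ {m v} → m ≢ r → v ≢ r → Adj m v → i ℕ.≤ τ m → i ℕ.≤ τ v → M m i ≤⁺ φ m v +⁺ M v i) →
    ∀ {d v} → Walk i d v → v ≢ r → φ₀ +⁺ M v i ≤⁺ d +⁺ M r′ i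
  walk-shift triangle (start _ _)           _   = ≤⁺-refl
  walk-shift triangle (step w u≢r mu i≤m) m≢r =
    ≤⁺-+⁺-shift (triangle m≢r u≢r mu i≤m (walk-index w)) (walk-shift triangle w u≢r)

  -- Soundness of a search

  Tight : ℕ → Carrier → Fin n → Set (c ⊔ ℓ₁)
  Tight i d v = d +⁺ M r i ≐ M v i

  tight⇒≢ : ∀ {i d v} → Walk i d v → Tight i d v → v ≢ r
  tight⇒≢ w t refl = 0<x⇒x+u≭u (0<walk w) t

  Reached : Fin n → ℕ → Set (c ⊔ ℓ₁)
  Reached v i = ∃ λ d → Walk i d v × Tight i d v

  -- An entry already raised. `below` keeps it out of later scans, so it is raised only once, and
  -- `covered` hands it to the repair.
  record Passed (σ : SearchState) (v : Fin n) (i : ℕ) : Set (c ⊔ ℓ₁) where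
    field
      below    : i ℕ.< level σ v
      covered  : ∃ λ A → affected σ v ≡ just A × i ∈ᴵ A
      reached  : Reached v i
      increase : labels σ v i ≡ Δ +⁺ M v i

  -- `walks` has no lower bound on the index: `Walk` is downward closed in it, and completeness
  -- needs walks for indices below an interval. In `hull`, `max A` lies below the level, so
  -- overwriting it after a later scan only enlarges the interval.
  record Sound (Q : List SearchEntry) (σ : SearchState) : Set (c ⊔ ℓ₁) where
    field
      walks   : ∀ {e} → e ∈ Q → ∀ {i} → i ℕ.≤ max (interval e) → i ℕ.≤ τ (vertex e) →
                Walk i (dist e) (vertex e)
      status  : ∀ v i → labels σ v i ≡ M v i ⊎ Passed σ v i
      visits  : ∀ {v} → v ∈ propagated σ → ∃ (Reached v)
      hull    : ∀ {v A} → affected σ v ≡ just A →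
                min A ℕ.≤ max A × max A ℕ.< level σ v × max A ℕ.≤ τ v

    -- The scan compares with the current row of `r`. Raising an entry there would take a tight walk
    -- back to `r`, which positivity of its weight forbids.
    labels-root : ∀ i → labels σ r i ≡ M r i
    labels-root i with status r i
    ... | inj₁ eq = eq
    ... | inj₂ p  = let d , w , t = Passed.reached p in contradiction t (0<x⇒x+u≭u (0<walk w))

    labels-above : ∀ {v i} → level σ v ℕ.≤ i → labels σ v i ≡ M v i
    labels-above {v} {i} lv≤i with status v i
    ... | inj₁ eq = eq
    ... | inj₂ p  = contradiction lv≤i (ℕ.<⇒≱ (Passed.below p))

    hit⇒tight : ∀ {d v i} → level σ v ℕ.≤ i → Hit Δ r d v (labels σ) i → Tight i d v
    hit⇒tight {d} lv≤i = subst₂ (λ x y → d +⁺ x ≐ y) (labels-root _) (labels-above lv≤i)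

    tight⇒hit : ∀ {d v i} → level σ v ℕ.≤ i → Tight i d v → Hit Δ r d v (labels σ) i
    tight⇒hit {d} lv≤i = subst₂ (λ x y → d +⁺ x ≐ y) (sym (labels-root _)) (sym (labels-above lv≤i))

  ∈-successors : ∀ {e d v J} → e ∈ map (λ (m , φₘ) → entry (d + φₘ) m J) (neighbours G v) →
                 ∃ λ m → Adj m v × e ≡ entry (d + φ m v) m J
  ∈-successors e∈ with ∈-map⁻ _ e∈
  ... | (m , _) , m∈ , refl with ∈-neighbours⁻ G m∈
  ...   | mv , refl = m , mv , refl

  updateAt-≥ : ∀ {f : Fin n → ℕ} {v k} → f v ℕ.≤ k → ∀ u → f u ℕ.≤ updateAt f v (const k) u
  updateAt-≥ {f} {v} {k} fv≤k u with u ≟ v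
  ... | yes refl = ℕ.≤-trans fv≤k (ℕ.≤-reflexive (sym (updateAt-updates v f)))
  ... | no u≢v   = ℕ.≤-reflexive (sym (updateAt-minimal u v f u≢v))

  level≤1+ : ∀ {v I h} σ → min I ℕ.⊔ level σ v ℕ.≤ h → level σ v ℕ.≤ suc h
  level≤1+ {v} {I} σ lo≤h = ℕ.m≤n⇒m≤1+n (ℕ.≤-trans (ℕ.m≤n⊔m (min I) (level σ v)) lo≤h)

  visit-sound : ∀ {e Q σ} → All (e ⊴_) Q → Sound (e ∷ Q) σ →
                let σ′ , new = visit Δ r e σ in Sound (new ++ Q) σ′
  visit-sound {entry d v I} {Q} {σ} _ S
    with visit Δ r (entry d v I) σ | visited Δ r d v I σ
  ... | _ | skip _ = record { Sound S ; walks = λ e∈ → Sound.walks S (there e∈) }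
  ... | _ | miss lo≤hi {L} scanned = record
    { walks = λ e∈ → walks (there e∈)
    ; status = status′
    ; visits = visits
    ; hull = λ {u} A≡ → let p , q , s = hull A≡ in p , ℕ.<-≤-trans q (raise u) , s
    }
    where
    open Sound S
    raise = updateAt-≥ {f = level σ} (level≤1+ {I = I} σ lo≤hi)
    L≡ : ∀ u i → L u i ≡ labels σ u i
    L≡ u i = Scanned.unchanged scanned u i λ (_ , p , q , h) → Scanned.none scanned refl p q h
    status′ : ∀ u i → _
    status′ u i with status u i
    ... | inj₁ eq = inj₁ (trans (L≡ u i) eq)
    ... | inj₂ p = inj₂ record
      { below = ℕ.<-≤-trans (Passed.below p) (raise u) ; covered = Passed.covered p
      ; reached = Passed.reached p ; increase = trans (L≡ u i) (Passed.increase p) }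
  ... | _ | hit lo≤hi {L} {J} scanned = record
    { walks = walks′
    ; status = status′
    ; visits = visits′
    ; hull = hull′
    }
    where
    open Sound S
    open Scanned scanned
    open Extremes (some refl)
    lo = min I ℕ.⊔ level σ v
    hi = max I ℕ.⊓ τ v
    level′ = updateAt (level σ) v (const (suc hi))
    affected′ = updateAt (affected σ) v λ A → just (extend A (min J) (max J))
    raise = updateAt-≥ {f = level σ} (level≤1+ {I = I} σ lo≤hi)
    lv≤ : ∀ {i} → lo ℕ.≤ i → level σ v ℕ.≤ i
    lv≤ = ℕ.≤-trans (ℕ.m≤n⊔m (min I) (level σ v))
    walk : ∀ {i} → i ℕ.≤ hi → Walk i d v
    walk i≤hi = walks (here refl) (ℕ.≤-trans i≤hi (ℕ.m⊓n≤m (max I) (τ v)))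
        (ℕ.≤-trans i≤hi (ℕ.m⊓n≤n (max I) (τ v)))
    max≤hi : max J ℕ.≤ hi
    max≤hi = ℕ.s≤s⁻¹ max<k
    reached′ : ∀ {i} → lo ℕ.≤ i → i ℕ.≤ hi → Hit Δ r d v (labels σ) i → Reached v i
    reached′ lo≤i i≤hi h = d , walk i≤hi , hit⇒tight (lv≤ lo≤i) h
    -- A hit at `r` would equate a label with itself plus a positive weight; hence the walks passed
    -- on to the neighbours have not returned to `r`.
    v≢r : v ≢ r
    v≢r refl = 0<x⇒x+u≭u (0<walk (walk ℕ.≤-refl)) min-hit

    walks′ : ∀ {e} → e ∈ map (λ (m , φₘ) → entry (d + φₘ) m J) (neighbours G v) ++ Q →
             ∀ {i} → i ℕ.≤ max (interval e) → i ℕ.≤ τ (vertex e) → Walk i (dist e) (vertex e)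
    walks′ e∈ i≤ i≤τ with ∈-++⁻ (map _ (neighbours G v)) e∈
    ... | inj₂ e∈Q = walks (there e∈Q) i≤ i≤τ
    ... | inj₁ e∈new with ∈-successors e∈new
    ...   | m , mv , refl = step (walk (ℕ.≤-trans i≤ max≤hi)) v≢r mv i≤τ

    visits′ : ∀ {u} → u ∈ v ∷ propagated σ → ∃ (Reached u)
    visits′ (there u∈)  = visits u∈
    visits′ (here refl) = min J , reached′ lo≤min (ℕ.≤-trans min≤max max≤hi) min-hit

    -- The old upper end is overwritten, but it lies below the level, and the scan starts no lower
    -- than the level.
    covers-old : ∀ {u i} → (∃ λ A → affected σ u ≡ just A × i ∈ᴵ A) →
                 ∃ λ A → affected′ u ≡ just A × i ∈ᴵ A
    covers-old {u} (A , A≡ , min≤i , i≤max) with u ≟ v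
    ... | no u≢v = A , trans (updateAt-minimal u v (affected σ) u≢v) A≡ , min≤i , i≤max
    ... | yes refl = ⟦ min A , max J ⟧
      , trans (updateAt-updates v (affected σ)) (cong (λ A → just (extend A (min J) (max J))) A≡)
      , min≤i , ℕ.≤-trans i≤max
          (ℕ.≤-trans (ℕ.<⇒≤ (proj₁ (proj₂ (hull A≡)))) (ℕ.≤-trans (lv≤ lo≤min) min≤max))

    covers-new : ∀ {i} → i ∈ᴵ J → ∃ λ A → affected′ v ≡ just A × i ∈ᴵ A
    covers-new (min≤i , i≤max) with affected σ v in A≡
    ... | nothing = J , trans (updateAt-updates v (affected σ))
        (cong (λ A → just (extend A (min J) (max J))) {y = nothing} A≡)
                  , min≤i , i≤max
    ... | just A = ⟦ min A , max J ⟧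
      , trans (updateAt-updates v (affected σ)) (cong (λ A → just (extend A (min J) (max J))) A≡)
      , (let p , q , _ = hull A≡ in ℕ.≤-trans p
          (ℕ.≤-trans (ℕ.<⇒≤ q) (ℕ.≤-trans (lv≤ lo≤min) min≤i))) , i≤max

    hull′ : ∀ {u A} → affected′ u ≡ just A → min A ℕ.≤ max A × max A ℕ.< level′ u × max A ℕ.≤ τ u
    hull′ {u} {A} A≡ with u ≟ v
    ... | no u≢v = let p , q , s = hull (trans (sym (updateAt-minimal u v (affected σ) u≢v)) A≡)
                   in p , ℕ.<-≤-trans q (raise u) , s
    ... | yes refl
      with refl ← trans (sym (updateAt-updates v (affected σ))) A≡ =
        min≤
      , (subst (max (extend (affected σ v) (min J) (max J)) ℕ.<_)
          (sym (updateAt-updates v (level σ))) (subst (ℕ._< suc hi) (sym max≡) max<k))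
      , subst (ℕ._≤ τ v) (sym max≡) (ℕ.≤-trans max≤hi (ℕ.m⊓n≤n (max I) (τ v)))
      where
      max≡ : max (extend (affected σ v) (min J) (max J)) ≡ max J
      max≡ with affected σ v
      ... | nothing = refl
      ... | just _  = refl
      min≤ : min (extend (affected σ v) (min J) (max J)) ℕ.≤
             max (extend (affected σ v) (min J) (max J))
      min≤ with affected σ v in B≡
      ... | nothing = min≤max
      ... | just B  =
        let p , q , _ = hull B≡
        in ℕ.≤-trans p (ℕ.≤-trans (ℕ.<⇒≤ q) (ℕ.≤-trans (lv≤ lo≤min) min≤max))

    status′ : ∀ u i → _
    status′ u i
      with u ≟ v ×-dec lo ℕ.≤? i ×-dec i ℕ.<? suc hi ×-dec (d +⁺ labels σ r i ≐? labels σ v i)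
    ... | yes (refl , lo≤i , i<1+hi , h) = inj₂ record
      { below    = ℕ.<-≤-trans i<1+hi (ℕ.≤-reflexive (sym (updateAt-updates v (level σ))))
      ; covered  = covers-new (hits lo≤i i<1+hi h)
      ; reached  = reached′ lo≤i (ℕ.s≤s⁻¹ i<1+hi) h
      ; increase = trans (increased lo≤i i<1+hi h) (cong (Δ +⁺_) (labels-above (lv≤ lo≤i))) }
    ... | no ¬p with status u i
    ...   | inj₁ eq = inj₁ (trans (unchanged u i ¬p) eq)
    ...   | inj₂ p = inj₂ record
      { below = ℕ.<-≤-trans (Passed.below p) (raise u) ; covered = covers-old (Passed.covered p)
      ; reached = Passed.reached p ; increase = trans (unchanged u i ¬p) (Passed.increase p) }

  initial : SearchState
  initial = record { labels = M ; level = const 0 ; affected = const nothing ; propagated = [] }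

  initialQueue : List SearchEntry
  initialQueue = entry φ₀ r′ ⟦ 0 , τ r ℕ.⊓ τ r′ ⟧ ∷ []

  Sound-resp-↭ : ∀ {Q Q′ σ} → Q ↭ Q′ → Sound Q σ → Sound Q′ σ
  Sound-resp-↭ Q↭Q′ S = record { Sound S ; walks = λ e∈ → Sound.walks S (∈-resp-↭ (↭-sym Q↭Q′) e∈) }

  sound-initial : Sound initialQueue initial
  sound-initial = record
    { walks  = λ { (here refl) i≤ i≤τ → start (ℕ.≤-trans i≤ (ℕ.m⊓n≤m (τ r) (τ r′))) i≤τ }
    ; status = λ _ _ → inj₁ refl
    ; visits = λ ()
    ; hull   = λ ()
    }

  search-sound : ∀ {σ} → Drain _⊴_ (visit Δ r) initialQueue initial σ → Sound [] σ
  search-sound drain = drain-invariant Sound Sound-resp-↭ visit-sound drain sound-initial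

  -- Completeness of a search at one index

  module Column (i : ℕ) (i≤r : i ℕ.≤ τ r) (i≤r′ : i ℕ.≤ τ r′)
                (triangle : ∀ {m v} → Adj m v → i ℕ.≤ τ m → i ℕ.≤ τ v → M m i ≤⁺ φ m v +⁺ M v i)
                (base : M r′ i ≤⁺ φ₀ +⁺ M r i) where

    walk-≤⁺ : ∀ {d v} → Walk i d v → M v i ≤⁺ d +⁺ M r i
    walk-≤⁺ (start _ _)      = base
    walk-≤⁺ (step w _ mu i≤m) = ≤⁺-+⁺ (triangle mu i≤m (walk-index w)) (walk-≤⁺ w)

    -- Tightness is demanded at every vertex because the search propagates only from hits. The end
    -- of a chain determines its weight up to `≈`.
    data Chain : Carrier → Fin n → Set (c ⊔ ℓ₁) where
      start : Tight i φ₀ r′ → Chain φ₀ r′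
      step  : ∀ {d u m} → Chain d u → Adj m u → i ℕ.≤ τ m → Tight i (d + φ m u) m →
          Chain (d + φ m u) m

    chain-tight : ∀ {d v} → Chain d v → Tight i d v
    chain-tight (start t)      = t
    chain-tight (step _ _ _ t) = t

    Pending : Fin n → Carrier → SearchEntry → Set ℓ₁
    Pending m d e = vertex e ≡ m × dist e ≈ d × i ∈ᴵ interval e

    Scheduled : List SearchEntry → SearchState → Fin n → Carrier → Set (c ⊔ ℓ₁)
    Scheduled Q σ m d = i ℕ.< level σ m ⊎ Any (Pending m d) Q

    -- Another entry for `v` in the queue is either strictly farther than `walk`, hence not tight,
    -- or tied with an upper end at most that of `I₀`, and then the level empties it.
    record LastVisit (Q : List SearchEntry) (σ : SearchState) (v : Fin n) : Set (c ⊔ ℓ₁ ⊔ ℓ₂) where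
      field
        {d₀}   : Carrier
        {I₀}   : Interval
        level≡ : level σ v ≡ suc (max I₀ ℕ.⊓ τ v)
        before : ∀ {e} → e ∈ Q → entry d₀ v I₀ ⊴ e
        walk   : i ℕ.≤ max I₀ ℕ.⊓ τ v → Walk i d₀ v

    -- `loose` justifies raised lower ends: an index cut off there cannot be tight at the queued
    -- distance. `settled` speaks of chains only, since a level may pass `i` at a vertex that is not
    -- tight.
    record Complete (Q : List SearchEntry) (σ : SearchState) : Set (c ⊔ ℓ₁ ⊔ ℓ₂) where
      field
        lastVisit : ∀ v → i ℕ.< level σ v → LastVisit Q σ v
        loose     : ∀ {e} → e ∈ Q → i ℕ.< min (interval e) → i ℕ.≤ τ (vertex e) →
            ¬ Tight i (dist e) (vertex e)
        settled   : ∀ {v d} → i ℕ.< level σ v → Chain d v →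
                    v ∈ propagated σ × (∀ {m} → Adj m v → i ℕ.≤ τ m → Scheduled Q σ m (d + φ m v))
        started   : Scheduled Q σ r′ φ₀

      -- Along the chain, the first vertex whose level has not passed `i` has a pending entry, and
      -- the remaining edges can only add to its distance.
      frontier : ∀ {v d} → Chain d v → i ℕ.< level σ v ⊎ Any (λ e → dist e ≤ d) Q
      frontier (start _) with started
      ... | inj₁ done    = inj₁ done
      ... | inj₂ pending = inj₂ (Any.map (λ (_ , eq , _) → ≤-reflexive eq) pending)
      frontier (step ch mu i≤m _) with frontier ch
      ... | inj₂ queued = inj₂ (Any.map (λ le → ≤-trans le (x≤x+y (φ-nonNegative mu))) queued)
      ... | inj₁ done with proj₂ (settled done ch) mu i≤m
      ...   | inj₁ done′   = inj₁ done′
      ...   | inj₂ pending = inj₂ (Any.map (λ (_ , eq , _) → ≤-reflexive eq) pending)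

    ⊴⇒≤ : ∀ e e′ → e ⊴ e′ → dist e ≤ dist e′
    ⊴⇒≤ _ _ (inj₁ (d≤d′ , _)) = d≤d′
    ⊴⇒≤ _ _ (inj₂ (d≈d′ , _)) = ≤-reflexive d≈d′

    ⊴-trans : ∀ e e′ e″ → e ⊴ e′ → e′ ⊴ e″ → e ⊴ e″
    ⊴-trans _ e′ e″ (inj₁ d<d′) e′⊴e″ = inj₁ (<-≤-trans d<d′ (⊴⇒≤ e′ e″ e′⊴e″))
    ⊴-trans _ _ _ (inj₂ (d≈d′ , _)) (inj₁ d′<d″) = inj₁ (≤-<-trans (≤-reflexive d≈d′) d′<d″)
    ⊴-trans _ _ _ (inj₂ (d≈d′ , p)) (inj₂ (d′≈d″ , q)) = inj₂ (Eq.trans d≈d′ d′≈d″ , ℕ.≤-trans q p)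

    -- An edge of weight zero creates a tie, which the upper ends decide; these never grow along a
    -- walk, so extraction never goes backwards.
    ⊴-successor : ∀ {d x} v I m J → 0# ≤ x → max J ℕ.≤ max I → entry d v I ⊴ entry (d + x) m J
    ⊴-successor {d} {x} v I m J 0≤x J≤I with d ≈? d + x
    ... | yes d≈d+x = inj₂ (d≈d+x , J≤I)
    ... | no d≉d+x  = inj₁ (x≤x+y 0≤x , d≉d+x)

    module _ {d v I Q σ} (S : Sound (entry d v I ∷ Q) σ) (C : Complete (entry d v I ∷ Q) σ) where
      open Sound S
      open Complete C

      skip-complete : max I ℕ.⊓ τ v ℕ.< min I ℕ.⊔ level σ v → Complete Q σ
      skip-complete hi<lo = record
        { lastVisit = λ u i<l → record { LastVisit (lastVisit u i<l) hiding (before)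
                                       ; before = λ e∈ → LastVisit.before (lastVisit u i<l)
                                           (there e∈) }
        ; loose     = λ e∈ → loose (there e∈)
        ; settled   = λ i<l ch → let p , q = settled i<l ch in p , λ mv i≤m → advance i≤m (q mv i≤m)
        ; started   = advance i≤r′ started
        }
        where
        advance : ∀ {m x} → i ℕ.≤ τ m → Scheduled (entry d v I ∷ Q) σ m x → Scheduled Q σ m x
        advance i≤m (inj₁ done) = inj₁ done
        advance i≤m (inj₂ (there pending)) = inj₂ pending
        -- `i` was in the interval before narrowing and is an index of `v`; as nothing is left, the
        -- level must have cut it off.
        advance i≤m (inj₂ (here (refl , _ , min≤i , i≤max))) = inj₁ (ℕ.≰⇒> λ l≤i →
          ℕ.<⇒≱ hi<lo (ℕ.≤-trans (ℕ.⊔-lub min≤i l≤i) (ℕ.⊓-glb i≤max i≤m)))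

      module _ (min-d : All (entry d v I ⊴_) Q) (lo≤hi : min I ℕ.⊔ level σ v ℕ.≤ max I ℕ.⊓ τ v)
          where
        private hi = max I ℕ.⊓ τ v

        walk : i ℕ.≤ hi → Walk i d v
        walk i≤hi = walks (here refl) (ℕ.≤-trans i≤hi (ℕ.m⊓n≤m (max I) (τ v)))
            (ℕ.≤-trans i≤hi (ℕ.m⊓n≤n (max I) (τ v)))

        -- A previous visit at the same distance had an upper end at least as large, so
        -- nothing would be left of the interval now.
        visited⇒loose : i ℕ.< level σ v → i ℕ.≤ hi → ¬ Tight i d v
        visited⇒loose i<l i≤hi t with lastVisit v i<l
        ... | lv with LastVisit.before lv (here refl)
        ...   | inj₁ d₀<d = <⇒≱ d₀<d (≐-cancel-≤ t (walk-≤⁺ (LastVisit.walk lv i≤hi₀)))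
          where i≤hi₀ = ℕ.s≤s⁻¹ (ℕ.<-≤-trans i<l (ℕ.≤-reflexive (LastVisit.level≡ lv)))
        ...   | inj₂ (_ , I≤I₀) =
            ℕ.<⇒≱ (ℕ.≤-<-trans (ℕ.⊓-monoˡ-≤ (τ v) I≤I₀) (ℕ.≤-reflexive (sym (LastVisit.level≡ lv))))
                                        (ℕ.≤-trans (ℕ.m≤n⊔m (min I) (level σ v)) lo≤hi)

        -- Dijkstra's argument: an entry on the way to v is queued at distance at most x, and the
        -- extracted entry precedes it.
        chain⇒tight : ∀ {x} → ¬ i ℕ.< level σ v → i ℕ.≤ hi → Chain x v → d ≈ x × Tight i d v
        chain⇒tight {x} i≮l i≤hi ch = d≈x , ≐-respˡ (Eq.sym d≈x) (chain-tight ch)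
          where
          d≤x : Any (λ e → dist e ≤ x) (entry d v I ∷ Q) → d ≤ x
          d≤x (here d≤x) = d≤x
          d≤x (there queued) =
            let e⊴ , e≤x = All.lookupAny min-d queued
            in ≤-trans (⊴⇒≤ (entry d v I) (Any.lookup queued) e⊴) e≤x
          d≈x : d ≈ x
          d≈x with frontier ch
          ... | inj₁ done   = contradiction done i≮l
          ... | inj₂ queued = antisym (d≤x queued)
                                        (≐-cancel-≤ (chain-tight ch) (walk-≤⁺ (walk i≤hi)))

        -- The common part of a scan with and without hits. Only `v` can newly pass `i`, and if it
        -- ends a chain then `chain⇒tight` makes the extracted distance tight; so the last premise
        -- is asked for in that case alone.
        visit-advance : ∀ {new σ′} → (∀ {u} → u ∈ propagated σ → u ∈ propagated σ′) →
          level σ′ ≡ updateAt (level σ) v (const (suc hi)) →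
          (∀ {e} → e ∈ new → entry d v I ⊴ e) →
          (∀ {e} → e ∈ new → i ℕ.< min (interval e) → i ℕ.≤ τ (vertex e) →
              ¬ Tight i (dist e) (vertex e)) →
          (¬ i ℕ.< level σ v → i ℕ.≤ hi → Tight i d v →
            v ∈ propagated σ′ × (∀ {m} → Adj m v → i ℕ.≤ τ m → Any (Pending m (d + φ m v)) new)) →
          Complete (new ++ Q) σ′
        visit-advance {new} {σ′} grow refl e⊴new new-loose settle = record
          { lastVisit = lastVisit′
          ; loose     = loose′
          ; settled   = settled′
          ; started   = advance i≤r′ started
          }
          where
          raise = updateAt-≥ {f = level σ} (level≤1+ {I = I} σ lo≤hi)

          e⊴ : ∀ {e} → e ∈ new ++ Q → entry d v I ⊴ e
          e⊴ e∈ with ∈-++⁻ new e∈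
          ... | inj₁ e∈new = e⊴new e∈new
          ... | inj₂ e∈Q   = All.lookup min-d e∈Q

          level-v : level σ′ v ≡ suc hi
          level-v = updateAt-updates v (level σ)

          advance : ∀ {m x} → i ℕ.≤ τ m → Scheduled (entry d v I ∷ Q) σ m x →
              Scheduled (new ++ Q) σ′ m x
          advance i≤m (inj₁ done) = inj₁ (ℕ.<-≤-trans done (raise _))
          advance i≤m (inj₂ (there pending)) = inj₂ (++⁺ʳ new pending)
          advance i≤m (inj₂ (here (refl , _ , _ , i≤max))) =
            inj₁ (ℕ.<-≤-trans (ℕ.s≤s (ℕ.⊓-glb i≤max i≤m)) (ℕ.≤-reflexive (sym level-v)))

          lastVisit′ : ∀ u → i ℕ.< level σ′ u → LastVisit (new ++ Q) σ′ u
          lastVisit′ u i<l with u ≟ v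
          ... | yes refl = record { d₀ = d ; I₀ = I ; level≡ = level-v ; before = e⊴ ; walk = walk }
          ... | no u≢v = record
            { d₀ = d₀ ; I₀ = I₀
            ; level≡ = trans (updateAt-minimal u v (level σ) u≢v) level≡
            ; before = λ {e} e∈ → ⊴-trans (entry d₀ u I₀) (entry d v I) e (before (here refl))
                (e⊴ e∈)
            ; walk = walk₀ }
            where
            open LastVisit (lastVisit u (subst (i ℕ.<_) (updateAt-minimal u v (level σ) u≢v) i<l))
                renaming (walk to walk₀)

          loose′ : ∀ {e} → e ∈ new ++ Q → i ℕ.< min (interval e) → i ℕ.≤ τ (vertex e) →
              ¬ Tight i (dist e) (vertex e)
          loose′ e∈ with ∈-++⁻ new e∈
          ... | inj₁ e∈new = new-loose e∈new
          ... | inj₂ e∈Q   = loose (there e∈Q)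

          settled′ : ∀ {u x} → i ℕ.< level σ′ u → Chain x u →
            u ∈ propagated σ′ × (∀ {m} → Adj m u → i ℕ.≤ τ m →
                Scheduled (new ++ Q) σ′ m (x + φ m u))
          settled′ {u} i<l ch with i ℕ.<? level σ u
          ... | yes done = let p , q = settled done ch in grow p , λ mu i≤m → advance i≤m (q mu i≤m)
          ... | no i≮l with u ≟ v
          ...   | no u≢v = contradiction (subst (i ℕ.<_) (updateAt-minimal u v (level σ) u≢v) i<l)
              i≮l
          ...   | yes refl =
            let i≤hi = ℕ.s≤s⁻¹ (ℕ.<-≤-trans i<l (ℕ.≤-reflexive level-v))
                d≈x , t = chain⇒tight i≮l i≤hi ch
                p , q = settle i≮l i≤hi t
            in p , λ mu i≤m → inj₂ (++⁺ˡ
                (Any.map (λ (v≡ , eq , i∈) → v≡ , Eq.trans eq (+-congʳ d≈x) , i∈) (q mu i≤m)))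

    visit-complete : ∀ {e Q σ} → All (e ⊴_) Q → Sound (e ∷ Q) σ → Complete (e ∷ Q) σ →
                     let σ′ , new = visit Δ r e σ in Complete (new ++ Q) σ′
    visit-complete {entry d v I} {Q} {σ} e⊴ S C
      with visit Δ r (entry d v I) σ | visited Δ r d v I σ
    ... | _ | skip hi<lo = skip-complete S C hi<lo
    ... | _ | miss lo≤hi scanned = visit-advance S C e⊴ lo≤hi (λ u∈ → u∈) refl (λ ()) (λ ()) settle
      where
      settle : ¬ i ℕ.< level σ v → i ℕ.≤ max I ℕ.⊓ τ v → Tight i d v → _
      settle i≮l i≤hi t with min I ℕ.≤? i
      ... | yes min≤i = contradiction (Sound.tight⇒hit S (ℕ.≮⇒≥ i≮l) t)
                          (Scanned.none scanned refl (ℕ.⊔-lub min≤i (ℕ.≮⇒≥ i≮l)) (ℕ.s≤s i≤hi))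
      ... | no min≰i  = contradiction t (Complete.loose C (here refl) (ℕ.≰⇒> min≰i)
                                          (ℕ.≤-trans i≤hi (ℕ.m⊓n≤n (max I) (τ v))))
    ... | _ | hit lo≤hi {L} {J} scanned =
      visit-advance S C e⊴ lo≤hi there refl e⊴new new-loose settle
      where
      open Scanned scanned
      open Extremes (some refl)
      max≤hi : max J ℕ.≤ max I ℕ.⊓ τ v
      max≤hi = ℕ.s≤s⁻¹ max<k
      new = map (λ (m , φₘ) → entry (d + φₘ) m J) (neighbours G v)

      e⊴new : ∀ {e} → e ∈ new → entry d v I ⊴ e
      e⊴new e∈ with ∈-successors e∈
      ... | m , mv , refl = ⊴-successor v I m J (φ-nonNegative mv)
          (ℕ.≤-trans max≤hi (ℕ.m⊓n≤m (max I) (τ v)))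

      -- There are three ways to fall below `min J`: below the level, where an earlier visit rules
      -- out tightness; below `min I`, where `loose` applies; or scanned without a hit.
      loose-v : i ℕ.< min J → ¬ Tight i d v
      loose-v i<min t with i ℕ.<? level σ v
      ... | yes i<l = visited⇒loose S C e⊴ lo≤hi i<l
          (ℕ.≤-trans (ℕ.<⇒≤ i<min) (ℕ.≤-trans min≤max max≤hi)) t
      ... | no i≮l with min I ℕ.≤? i
      ...   | no min≰i  = Complete.loose C (here refl) (ℕ.≰⇒> min≰i)
                            (ℕ.≤-trans (ℕ.<⇒≤ i<min) (ℕ.≤-trans min≤max
                                (ℕ.≤-trans max≤hi (ℕ.m⊓n≤n (max I) (τ v))))) t
      ...   | yes min≤i = ℕ.<⇒≱ i<min (proj₁ (hits (ℕ.⊔-lub min≤i (ℕ.≮⇒≥ i≮l))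
                            (ℕ.<-trans i<min (ℕ.≤-<-trans min≤max max<k))
                                (Sound.tight⇒hit S (ℕ.≮⇒≥ i≮l) t)))

      new-loose : ∀ {e} → e ∈ new → i ℕ.< min (interval e) → i ℕ.≤ τ (vertex e) →
          ¬ Tight i (dist e) (vertex e)
      new-loose e∈ i<min i≤m t with ∈-successors e∈
      ... | m , mv , refl = loose-v i<min (≐-pred t (triangle mv i≤m (walk-index w)) (walk-≤⁺ w))
        where w = walk S C e⊴ lo≤hi (ℕ.≤-trans (ℕ.<⇒≤ i<min) (ℕ.≤-trans min≤max max≤hi))

      settle : ¬ i ℕ.< level σ v → i ℕ.≤ max I ℕ.⊓ τ v → Tight i d v →
               v ∈ v ∷ propagated σ × (∀ {m} → Adj m v → i ℕ.≤ τ m →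
                   Any (Pending m (d + φ m v)) new)
      settle i≮l i≤hi t with min I ℕ.≤? i
      ... | no min≰i  = contradiction t (Complete.loose C (here refl) (ℕ.≰⇒> min≰i)
                                          (ℕ.≤-trans i≤hi (ℕ.m⊓n≤n (max I) (τ v))))
      ... | yes min≤i = here refl , λ {m} mv i≤m →
        Any.map (λ { refl → refl , Eq.refl , i∈J })
            (∈-map⁺ (λ (m , φₘ) → entry (d + φₘ) m J) (∈-neighbours⁺ G mv))
        where i∈J = hits (ℕ.⊔-lub min≤i (ℕ.≮⇒≥ i≮l)) (ℕ.s≤s i≤hi) (Sound.tight⇒hit S (ℕ.≮⇒≥ i≮l) t)

    complete-initial : Complete initialQueue initial
    complete-initial = record
      { lastVisit = λ _ ()
      ; loose     = λ { (here refl) () }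
      ; settled   = λ ()
      ; started   = inj₂ (here (refl , Eq.refl , ℕ.z≤n , ℕ.⊓-glb i≤r i≤r′))
      }

    Complete-resp-↭ : ∀ {Q Q′ σ} → Q ↭ Q′ → Complete Q σ → Complete Q′ σ
    Complete-resp-↭ {Q} {Q′} {σ} Q↭Q′ C = record
      { lastVisit = λ u i<l → record { LastVisit (lastVisit u i<l) hiding (before)
                                     ; before = λ e∈ → LastVisit.before (lastVisit u i<l)
                                         (∈-resp-↭ (↭-sym Q↭Q′) e∈) }
      ; loose     = λ e∈ → loose (∈-resp-↭ (↭-sym Q↭Q′) e∈)
      ; settled   = λ i<l ch → let p , q = settled i<l ch in p , λ mv i≤m → move (q mv i≤m)
      ; started   = move started
      }
      where
      open Complete C
      move : ∀ {m x} → Scheduled Q σ m x → Scheduled Q′ σ m x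
      move (inj₁ done)    = inj₁ done
      move (inj₂ pending) = inj₂ (Any-resp-↭ Q↭Q′ pending)

    -- With an empty queue, `frontier` can only report a passed level.
    search-complete : ∀ {σ v d} → Drain _⊴_ (visit Δ r) initialQueue initial σ → Chain d v →
        v ∈ propagated σ
    search-complete {σ} drain ch = proj₁ (settled (done ch) ch)
      where
      final : Sound [] σ × Complete [] σ
      final = drain-invariant (λ Q σ → Sound Q σ × Complete Q σ)
        (λ Q↭ (S , C) → Sound-resp-↭ Q↭ S , Complete-resp-↭ Q↭ C)
        (λ e⊴ (S , C) → visit-sound e⊴ S , visit-complete e⊴ S C)
        drain (sound-initial , complete-initial)
      open Complete (proj₂ final)
      done : ∀ {v d} → Chain d v → i ℕ.< level σ v
      done ch with frontier ch
      ... | inj₁ d = d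

-- Repair

T-does⁻ : ∀ {a} {A : Set a} (a? : Dec A) → T (does a?) → A
T-does⁻ (yes a) _ = a

T-does⁺ : ∀ {a} {A : Set a} (a? : Dec A) → A → T (does a?)
T-does⁺ a? a = subst T (sym (dec-true a? a)) _

module RepairProperties {c ℓ₁ ℓ₂} {F : OrderedField c ℓ₁ ℓ₂} {n : ℕ}
                        (G G′ : RoadNetwork F n) (τ : Fin n → ℕ) where
  open OrderedFieldProperties F
  open Algorithm G G′ τ
  open RoadNetwork G′

  -- L bounds all labels from below; L₀ are the labels the repair starts from.
  module From
    (affected : Affected) (affected≤τ : ∀ {v i} → i ∈ indices (affected v) → i ℕ.≤ τ v)
    (L L₀ : Labels F n) (L≤L₀ : ∀ {v i} → i ℕ.≤ τ v → L v i ≤⁺ L₀ v i)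
    (triangle : ∀ {m v i} → Adj m v → i ℕ.≤ τ m → i ℕ.≤ τ v → L m i ≤⁺ φ m v +⁺ L v i) where

    open VisitProperties G G′ τ
    open DecMembership ℕ._≟_ using (_∈?_)

    φ-swap : ∀ {m v x} → Adj m v → φ v m +⁺ x ≤⁺ φ m v +⁺ x
    φ-swap mv = +⁺-mono-≤⁺ (≤-reflexive (Eq.sym (φ-sym mv))) ≤⁺-refl

    -- An inequality instead of an equation, since an entry may carry the weight of the edge read in
    -- the other orientation, which agrees only up to `≈`.
    Improves : Fin n → ℕ → Carrier ⁺ → RepairEntry → Set (c ⊔ ℓ₂)
    Improves v i x (d , u , j) = u ≡ v × j ≡ i × d ≤⁺ x

    -- Each edge into an affected entry is relaxed or has a queued entry that will relax it; the
    -- empty queue leaves the triangle inequality. `entries` maintains `lower`, since a queued value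
    -- may become a label.
    record Relaxing (Q : List RepairEntry) (M : Labels F n) : Set (c ⊔ ℓ₂) where
      field
        lower   : ∀ {v i} → i ℕ.≤ τ v → L v i ≤⁺ M v i
        upper   : ∀ v i → M v i ≤⁺ L₀ v i
        entries : ∀ {d v i} → (d , v , i) ∈ Q → i ℕ.≤ τ v × L v i ≤⁺ d
        relaxed : ∀ {m v i} → Adj m v → i ∈ indices (affected v) → i ℕ.≤ τ m →
                  M v i ≤⁺ φ m v +⁺ M m i ⊎ Any (Improves v i (φ m v +⁺ M m i)) Q

    Relaxing-resp-↭ : ∀ {Q Q′ M} → Q ↭ Q′ → Relaxing Q M → Relaxing Q′ M
    Relaxing-resp-↭ {Q} {Q′} {M} Q↭Q′ R = record
      { Relaxing R hiding (entries; relaxed)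
      ; entries = λ e∈ → Relaxing.entries R (∈-resp-↭ (↭-sym Q↭Q′) e∈)
      ; relaxed = relaxed′
      }
      where
      relaxed′ : ∀ {m v i} → Adj m v → i ∈ indices (affected v) → i ℕ.≤ τ m →
                 M v i ≤⁺ φ m v +⁺ M m i ⊎ Any (Improves v i (φ m v +⁺ M m i)) Q′
      relaxed′ mv i∈ i≤m with Relaxing.relaxed R mv i∈ i≤m
      ... | inj₁ le = inj₁ le
      ... | inj₂ im = inj₂ (Any-resp-↭ Q↭Q′ im)

    relaxing-initial : Relaxing (repairQueue affected L₀) L₀
    relaxing-initial = record
      { lower   = L≤L₀
      ; upper   = λ _ _ → ≤⁺-refl
      ; entries = entries
      ; relaxed = relaxed
      }
      where
      improving : Fin n → Fin n × Carrier → ℕ → Bool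
      improving v (m , φₘ) i = does (i ℕ.≤? τ m) ∧ does (φₘ +⁺ L₀ m i <⁺? L₀ v i)

      candidates : Fin n → Fin n × Carrier → List RepairEntry
      candidates v (m , φₘ) = map (λ i → φₘ +⁺ L₀ m i , v , i)
          (filterᵇ (improving v (m , φₘ)) (indices (affected v)))

      entries : ∀ {d v i} → (d , v , i) ∈ repairQueue affected L₀ → i ℕ.≤ τ v × L v i ≤⁺ d
      entries e∈
        with v , _ , e∈′ ← find (∈-concatMap⁻ (λ v → concatMap (candidates v) (neighbours G′ v))
            {xs = allFin n} e∈)
        with (m , _) , m∈ , e∈″ ← find (∈-concatMap⁻ (candidates v) {xs = neighbours G′ v} e∈′)
        with mv , refl ← ∈-neighbours⁻ G′ m∈
        with i , i∈ , refl , imp ← ∈-map∘filter⁻ (λ i → φ m v +⁺ L₀ m i , v , i)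
            (T? ∘ improving v (m , φ m v))
                                     {xs = indices (affected v)} e∈″ =
          i≤v , ≤⁺-trans (triangle (adj-sym mv) i≤v i≤m)
                  (≤⁺-trans (φ-swap mv) (+⁺-mono-≤⁺ ≤-refl (L≤L₀ i≤m)))
        where
        i≤v = affected≤τ i∈
        i≤m = T-does⁻ (i ℕ.≤? τ m) (proj₁ (Equivalence.to T-∧ imp))

      relaxed : ∀ {m v i} → Adj m v → i ∈ indices (affected v) → i ℕ.≤ τ m →
                L₀ v i ≤⁺ φ m v +⁺ L₀ m i ⊎ Any (Improves v i (φ m v +⁺ L₀ m i))
                    (repairQueue affected L₀)
      relaxed {m} {v} {i} mv i∈ i≤m with φ m v +⁺ L₀ m i <⁺? L₀ v i
      ... | no ≮   = inj₁ (≮⁺⇒≥⁺ ≮)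
      ... | yes lt = inj₂ (Any.map (λ { refl → refl , refl , ≤⁺-refl }) e∈)
        where
        e∈ : (φ m v +⁺ L₀ m i , v , i) ∈ repairQueue affected L₀
        e∈ = ∈-concatMap⁺ (λ v → concatMap (candidates v) (neighbours G′ v)) (Any.map (λ { refl →
             ∈-concatMap⁺ (candidates v) (Any.map (λ { refl →
               ∈-map∘filter⁺ (λ i → φ m v +⁺ L₀ m i , v , i) (T? ∘ improving v (m , φ m v))
                 (i , i∈ , refl , Equivalence.from T-∧ (T-does⁺ (i ℕ.≤? τ m) i≤m ,
                     T-does⁺ (_ <⁺? _) lt)) })
             (∈-neighbours⁺ G′ mv)) }) (∈-allFin v))

    visit-relaxing : ∀ {e Q M} → All (e ⊴ᴿ_) Q → Relaxing (e ∷ Q) M →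
                     let M′ , new = repairVisit affected e M in Relaxing (new ++ Q) M′
    visit-relaxing {d , v , i} {Q} {M} _ R with d <⁺? M v i
    ... | no d≮ = record
      { Relaxing R hiding (entries; relaxed)
      ; entries = λ e∈ → entries (there e∈)
      ; relaxed = relaxed′
      }
      where
      open Relaxing R
      relaxed′ : ∀ {m u j} → Adj m u → j ∈ indices (affected u) → j ℕ.≤ τ m →
                 M u j ≤⁺ φ m u +⁺ M m j ⊎ Any (Improves u j (φ m u +⁺ M m j)) Q
      relaxed′ mu j∈ j≤m with relaxed mu j∈ j≤m
      ... | inj₁ le = inj₁ le
      ... | inj₂ (there im) = inj₂ im
      ... | inj₂ (here (refl , refl , d≤)) = inj₁ (≤⁺-trans (≮⁺⇒≥⁺ d≮) d≤)
    ... | yes d< = record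
      { lower   = lower′
      ; upper   = λ u j → ≤⁺-trans (decrease u j) (upper u j)
      ; entries = entries′
      ; relaxed = relaxed′
      }
      where
      open Relaxing R
      M′ = setLabel M v i d
      improving : Fin n × Carrier → Bool
      improving (m , φₘ) = does (i ∈? indices (affected m)) ∧ does (φₘ +⁺ M′ v i <⁺? M′ m i)
      new = map (λ (m , φₘ) → φₘ +⁺ M′ v i , m , i) (filterᵇ improving (neighbours G′ v))

      at? : ∀ u j → Dec (u ≡ v × j ≡ i)
      at? u j = u ≟ v ×-dec j ℕ.≟ i

      decrease : ∀ u j → M′ u j ≤⁺ M u j
      decrease u j with at? u j
      ... | yes (refl , refl) = ≤⁺-trans (≤⁺-reflexive (setLabel-updates M v i d)) (<⁺⇒≤⁺ d<)
      ... | no ≢vi            = ≤⁺-reflexive (setLabel-minimal M v i d u j ≢vi)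

      lower′ : ∀ {u j} → j ℕ.≤ τ u → L u j ≤⁺ M′ u j
      lower′ {u} {j} j≤u with at? u j
      ... | yes (refl , refl) =
          ≤⁺-trans (proj₂ (entries (here refl))) (≤⁺-reflexive (sym (setLabel-updates M v i d)))
      ... | no ≢vi            =
          ≤⁺-trans (lower j≤u) (≤⁺-reflexive (sym (setLabel-minimal M v i d u j ≢vi)))

      entries′ : ∀ {x u j} → (x , u , j) ∈ new ++ Q → j ℕ.≤ τ u × L u j ≤⁺ x
      entries′ e∈ with ∈-++⁻ new e∈
      ... | inj₂ e∈Q = entries (there e∈Q)
      ... | inj₁ e∈new
        with (m , _) , m∈ , refl , imp ← ∈-map∘filter⁻ (λ (m , φₘ) → φₘ +⁺ M′ v i , m , i)
            (T? ∘ improving)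
                                     {xs = neighbours G′ v} e∈new
        with mv , refl ← ∈-neighbours⁻ G′ m∈ =
          i≤m , ≤⁺-trans (triangle mv i≤m i≤v) (+⁺-mono-≤⁺ ≤-refl (lower′ i≤v))
        where
        i≤v = proj₁ (entries (here refl))
        i≤m = affected≤τ (T-does⁻ (i ∈? indices (affected m)) (proj₁ (Equivalence.to T-∧ imp)))

      relaxed′ : ∀ {m u j} → Adj m u → j ∈ indices (affected u) → j ℕ.≤ τ m →
                 M′ u j ≤⁺ φ m u +⁺ M′ m j ⊎ Any (Improves u j (φ m u +⁺ M′ m j)) (new ++ Q)
      -- Lowering the target of an edge preserves its inequality; only lowering the source can break
      -- it, and then the new entries restore it.
      relaxed′ {m} {u} {j} mu j∈ j≤m with at? m j
      ... | no ≢vi rewrite setLabel-minimal M v i d m j ≢vi with relaxed mu j∈ j≤m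
      ...   | inj₁ le = inj₁ (≤⁺-trans (decrease u j) le)
      ...   | inj₂ (there im) = inj₂ (++⁺ʳ new im)
      ...   | inj₂ (here (refl , refl , d≤)) = inj₁
          (≤⁺-trans (≤⁺-reflexive (setLabel-updates M v i d)) d≤)
      relaxed′ {m} {u} {j} mu j∈ j≤m | yes (refl , refl) with φ u v +⁺ M′ v i <⁺? M′ u i
      ... | no ≮   = inj₁ (≤⁺-trans (≮⁺⇒≥⁺ ≮) (φ-swap mu))
      ... | yes lt = inj₂ (++⁺ˡ (Any.map (λ { refl → refl , refl , φ-swap mu }) e∈))
        where
        e∈ : (φ u v +⁺ M′ v i , u , i) ∈ new
        e∈ = ∈-map∘filter⁺ (λ (m , φₘ) → φₘ +⁺ M′ v i , m , i) (T? ∘ improving)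
               ((u , φ u v) , ∈-neighbours⁺ G′ (adj-sym mu) , refl
               , Equivalence.from T-∧ (T-does⁺ (i ∈? indices (affected u)) j∈ ,
                   T-does⁺ (_ <⁺? _) lt))

    repair-relaxed : ∀ {M} → Drain _⊴ᴿ_ (repairVisit affected) (repairQueue affected L₀) L₀ M →
        Relaxing [] M
    repair-relaxed drain = drain-invariant Relaxing Relaxing-resp-↭ visit-relaxing drain
        relaxing-initial

-- Ancestors and label indices

module _ {a p q} {A : Set a} {P : Pred A p} {Q : Pred A q} (P? : Unary.Decidable P)
    (Q? : Unary.Decidable Q) where

  count-mono-≤ : ∀ {k} {xs : Vec.Vec A k} → Vecᴬ.All (λ x → P x → Q x) xs →
      Vec.count P? xs ℕ.≤ Vec.count Q? xs
  count-mono-≤ Vecᴬ.[] = z≤n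
  count-mono-≤ {xs = x Vec.∷ _} (P⇒Q Vecᴬ.∷ P⊆Q) with P? x | Q? x
  ... | yes px | yes _  = s≤s (count-mono-≤ P⊆Q)
  ... | yes px | no ¬qx = contradiction (P⇒Q px) ¬qx
  ... | no _   | yes _  = ℕ.m≤n⇒m≤1+n (count-mono-≤ P⊆Q)
  ... | no _   | no _   = count-mono-≤ P⊆Q

  count-mono-< : ∀ {k w} {xs : Vec.Vec A k} → (∀ {x} → P x → Q x) → w Vec.∈ xs → ¬ P w → Q w →
                 Vec.count P? xs ℕ.< Vec.count Q? xs
  count-mono-< {xs = x Vec.∷ xs} P⊆Q (Vecᴱ.here refl) ¬pw qw with P? x | Q? x
  ... | yes px | _      = contradiction px ¬pw
  ... | no _   | yes _  = s≤s (count-mono-≤ (Vecᴬ.universal (λ _ → P⊆Q) xs))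
  ... | no _   | no ¬qw = contradiction qw ¬qw
  count-mono-< {xs = x Vec.∷ xs} P⊆Q (Vecᴱ.there w∈) ¬pw qw with P? x | Q? x
  ... | yes px | yes _  = s≤s (count-mono-< P⊆Q w∈ ¬pw qw)
  ... | yes px | no ¬qx = contradiction (P⊆Q px) ¬qx
  ... | no _   | yes _  = ℕ.m<n⇒m<1+n (count-mono-< P⊆Q w∈ ¬pw qw)
  ... | no _   | no _   = count-mono-< P⊆Q w∈ ¬pw qw

  -- Only `w` can be lost, and in a vector without repetitions it is lost once.
  count-≤-suc : ∀ {k w} {xs : Vec.Vec A k} → Unique xs → (∀ {x} → x ≢ w → P x → Q x) →
                (∀ x → Dec (x ≡ w)) → Vec.count P? xs ℕ.≤ suc (Vec.count Q? xs)
  count-≤-suc {xs = Vec.[]} _ _ _ = z≤n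
  count-≤-suc {w = w} {xs = x Vec.∷ xs} (x∉xs ∷ uniq) P⊆Q ≟w with ≟w x
  ... | yes refl with P? x | Q? x | count-mono-≤ (Vecᴬ.map (λ x≢y → P⊆Q λ y≡x → x≢y (sym y≡x)) x∉xs)
  ...   | yes _ | yes _ | le = s≤s (ℕ.m≤n⇒m≤1+n le)
  ...   | yes _ | no _  | le = s≤s le
  ...   | no _  | yes _ | le = ℕ.m≤n⇒m≤1+n (ℕ.m≤n⇒m≤1+n le)
  ...   | no _  | no _  | le = ℕ.m≤n⇒m≤1+n le
  count-≤-suc {w = w} {xs = x Vec.∷ xs} (x∉xs ∷ uniq) P⊆Q ≟w | no x≢w
    with P? x | Q? x | count-≤-suc uniq P⊆Q ≟w
  ...   | yes _  | yes _  | le = s≤s le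
  ...   | yes px | no ¬qx | le = contradiction (P⊆Q x≢w px) ¬qx
  ...   | no _   | yes _  | le = ℕ.m≤n⇒m≤1+n le
  ...   | no _   | no _   | le = le

0<count⇒∃ : ∀ {a p} {A : Set a} {P : Pred A p} (P? : Unary.Decidable P) {k} (xs : Vec.Vec A k) →
            0 ℕ.< Vec.count P? xs → ∃ P
0<count⇒∃ P? (x Vec.∷ xs) 0<c with P? x
... | yes px = x , px
... | no _   = 0<count⇒∃ P? xs 0<c

⊑-refl : ∀ {t} {N : Node t} → N ⊑ N
⊑-refl {N = root}    = root
⊑-refl {N = left N}  = left ⊑-refl
⊑-refl {N = right N} = right ⊑-refl

⊑-trans : ∀ {t} {N M K : Node t} → N ⊑ M → M ⊑ K → N ⊑ K
⊑-trans root      _         = root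
⊑-trans (left p)  (left q)  = left (⊑-trans p q)
⊑-trans (right p) (right q) = right (⊑-trans p q)

⊑-antisym : ∀ {t} {N M : Node t} → N ⊑ M → M ⊑ N → N ≡ M
⊑-antisym root      root      = refl
⊑-antisym (left p)  (left q)  = cong left (⊑-antisym p q)
⊑-antisym (right p) (right q) = cong right (⊑-antisym p q)

⊑-linear : ∀ {t} {N M K : Node t} → N ⊑ K → M ⊑ K → N ⊑ M ⊎ M ⊑ N
⊑-linear root      _         = inj₁ root
⊑-linear (left _)  root      = inj₂ root
⊑-linear (right _) root      = inj₂ root
⊑-linear (left p)  (left q)  with ⊑-linear p q
... | inj₁ r = inj₁ (left r)
... | inj₂ r = inj₂ (left r)
⊑-linear (right p) (right q) with ⊑-linear p q
... | inj₁ r = inj₁ (right r)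
... | inj₂ r = inj₂ (right r)

module HierarchyProperties {c ℓ₁ ℓ₂} {F : OrderedField c ℓ₁ ℓ₂} {n} {G : RoadNetwork F n}
                           (T : StableTreeHierarchy G)
                           {_≤ₜ_ : Rel (Fin n) 0ℓ} (O : IsDecTotalOrder _≡_ _≤ₜ_) where
  open StableTreeHierarchy T
  open RoadNetwork G
  private
    module O = IsDecTotalOrder O
    _⪯_ = Precedes T O

  ⪯⇒⊑ : ∀ {w v} → w ⪯ v → ℓ w ⊑ ℓ v
  ⪯⇒⊑ (inj₁ (w⊑v , _)) = w⊑v
  ⪯⇒⊑ {w} (inj₂ (eq , _)) = subst (ℓ w ⊑_) eq ⊑-refl

  ⊑⇒comparable : ∀ {w v} → ℓ w ⊑ ℓ v → w ⪯ v ⊎ v ⪯ w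
  ⊑⇒comparable {w} {v} w⊑v with ℓ w ≟ᴺ ℓ v | O.total w v
  ... | no w≢v | _          = inj₁ (inj₁ (w⊑v , w≢v))
  ... | yes eq | inj₁ w≤v = inj₁ (inj₂ (eq , w≤v))
  ... | yes eq | inj₂ v≤w = inj₂ (inj₂ (sym eq , v≤w))

  ⪯-refl : ∀ {v} → v ⪯ v
  ⪯-refl = inj₂ (refl , O.refl)

  ⪯-trans : ∀ {u v w} → u ⪯ v → v ⪯ w → u ⪯ w
  ⪯-trans (inj₂ (eq , p)) (inj₂ (eq′ , q)) = inj₂ (trans eq eq′ , O.trans p q)
  ⪯-trans {w = w} (inj₂ (eq , p)) (inj₁ (v⊑w , v≢w)) =
    inj₁ (subst (_⊑ ℓ w) (sym eq) v⊑w , λ u≡w → v≢w (trans (sym eq) u≡w))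
  ⪯-trans {v = v} (inj₁ (u⊑v , u≢v)) v⪯w =
    inj₁ (⊑-trans u⊑v (⪯⇒⊑ v⪯w) , λ u≡w → u≢v (⊑-antisym u⊑v (subst (ℓ v ⊑_) (sym u≡w) (⪯⇒⊑ v⪯w))))

  ⪯-antisym : ∀ {u v} → u ⪯ v → v ⪯ u → u ≡ v
  ⪯-antisym (inj₂ (_ , p)) (inj₂ (_ , q)) = O.antisym p q
  ⪯-antisym (inj₁ (u⊑v , u≢v)) v⪯u = contradiction (⊑-antisym u⊑v (⪯⇒⊑ v⪯u)) u≢v
  ⪯-antisym u⪯v (inj₁ (v⊑u , v≢u)) = contradiction (⊑-antisym v⊑u (⪯⇒⊑ u⪯v)) v≢u

  ⪯-linear : ∀ {u v w} → u ⪯ w → v ⪯ w → u ⪯ v ⊎ v ⪯ u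
  ⪯-linear u⪯w v⪯w with ⊑-linear (⪯⇒⊑ u⪯w) (⪯⇒⊑ v⪯w)
  ... | inj₁ u⊑v = ⊑⇒comparable u⊑v
  ... | inj₂ v⊑u = swap (⊑⇒comparable v⊑u)

  -- The path consisting of this edge must meet a common ancestor of its ends, and it has no other
  -- vertices.
  adjacent-comparable : ∀ {u v} → Adj u v → u ⪯ v ⊎ v ⪯ u
  adjacent-comparable {u} {v} uv
    with separating {u} {v} {u ∷ v ∷ []}
           record { linked = uv ∷ [-] ; start = refl ; end = refl ; inside = _ ∷ _ ∷ [] }
  ... | here (_ , u⊑v)         = ⊑⇒comparable u⊑v
  ... | there (here (v⊑u , _)) = swap (⊑⇒comparable v⊑u)

  Before : Fin n → Pred (Fin n) 0ℓ
  Before v w = w ⪯ v × w ≢ v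

  before? : ∀ v → Unary.Decidable (Before v)
  before? v w = precedes? T O w v ×-dec ¬? (w ≟ v)

  τ-mono-< : ∀ {v w} → Before w v → τ T O v ℕ.< τ T O w
  τ-mono-< {v} {w} (v⪯w , v≢w) = count-mono-< (before? v) (before? w)
    (λ (x⪯v , x≢v) → ⪯-trans x⪯v v⪯w , λ { refl → x≢v (⪯-antisym x⪯v v⪯w) })
    (Vec.∈-allFin⁺ v) (λ (_ , v≢v) → v≢v refl) (v⪯w , v≢w)

  τ-mono-≤ : ∀ {v w} → v ⪯ w → τ T O v ℕ.≤ τ T O w
  τ-mono-≤ {v} {w} v⪯w with v ≟ w
  ... | yes refl = ℕ.≤-refl
  ... | no v≢w   = ℕ.<⇒≤ (τ-mono-< (v⪯w , v≢w))

  -- Why the algorithm may compare indices in place of testing membership in G[Desc(w)]: a neighbour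
  -- above `u` shares a branch with `w`, and were it strictly above `w` its index would be too
  -- small.
  descend : ∀ {u v w} → Adj u v → w ⪯ u → τ T O w ℕ.≤ τ T O v → w ⪯ v
  descend {u} {v} {w} uv w⪯u τw≤τv with adjacent-comparable uv
  ... | inj₁ u⪯v = ⪯-trans w⪯u u⪯v
  ... | inj₂ v⪯u with ⪯-linear w⪯u v⪯u | v ≟ w
  ...   | inj₁ w⪯v | _        = w⪯v
  ...   | inj₂ v⪯w | yes refl = ⪯-refl
  ...   | inj₂ v⪯w | no v≢w   = contradiction τw≤τv (ℕ.<⇒≱ (τ-mono-< (v⪯w , v≢w)))

  greatestBefore : ∀ v xs → (∀ {x} → x ∈ xs → ¬ Before v x) ⊎
                            (∃ λ w → Before v w × (∀ {x} → x ∈ xs → Before v x → x ⪯ w))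
  greatestBefore v [] = inj₁ λ ()
  greatestBefore v (x ∷ xs) with before? v x | greatestBefore v xs
  ... | no ¬x | inj₁ none = inj₁ λ { (here refl) → ¬x ; (there y∈) → none y∈ }
  ... | no ¬x | inj₂ (w , w<v , max) =
      inj₂ (w , w<v , λ { (here refl) x<v → contradiction x<v ¬x ; (there y∈) → max y∈ })
  ... | yes x<v | inj₁ none =
      inj₂ (x , x<v , λ { (here refl) _ → ⪯-refl ; (there y∈) y<v → contradiction y<v (none y∈) })
  ... | yes x<v | inj₂ (w , w<v , max) with ⪯-linear (proj₁ x<v) (proj₁ w<v)
  ...   | inj₁ x⪯w = inj₂ (w , w<v , λ { (here refl) _ → x⪯w ; (there y∈) → max y∈ })
  ...   | inj₂ w⪯x = inj₂ (x , x<v ,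
      λ { (here refl) _ → ⪯-refl ; (there y∈) y<v → ⪯-trans (max y∈ y<v) w⪯x })

  predecessor : ∀ v → 0 ℕ.< τ T O v → ∃ λ w → Before v w × τ T O v ℕ.≤ suc (τ T O w)
  predecessor v 0<τ with greatestBefore v (allFin n)
  ... | inj₁ none =
    let x , x<v = 0<count⇒∃ (before? v) (Vec.allFin n) 0<τ
    in contradiction x<v (none (∈-allFin x))
  ... | inj₂ (w , w<v , max) = w , w<v ,
    count-≤-suc (before? v) (before? w) (tabulate⁺ λ eq → eq)
      (λ x≢w x<v → max (∈-allFin _) x<v , x≢w) (_≟ w)

  -- Passing to a predecessor lowers the index by at most one, so the climb cannot jump over `i`;
  -- `k` is its fuel.
  ancestor-at : ∀ v {i} → i ℕ.≤ τ T O v → ∃ λ w → w ⪯ v × τ T O w ≡ i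
  ancestor-at v {i} = climb (suc (τ T O v)) v ℕ.≤-refl
    where
    climb : ∀ k v → τ T O v ℕ.< k → i ℕ.≤ τ T O v → ∃ λ w → w ⪯ v × τ T O w ≡ i
    climb (suc k) v τ<1+k i≤τ with ℕ.m≤n⇒m<n∨m≡n i≤τ
    ... | inj₂ i≡τ = v , ⪯-refl , sym i≡τ
    ... | inj₁ i<τ =
      let u , u<v , τv≤ = predecessor v (ℕ.≤-<-trans z≤n i<τ)
          w , w⪯u , eq = climb k u (ℕ.<-≤-trans (τ-mono-< u<v) (ℕ.s≤s⁻¹ τ<1+k))
              (ℕ.s≤s⁻¹ (ℕ.<-≤-trans i<τ τv≤))
      in w , ⪯-trans w⪯u (proj₁ u<v) , eq

-- Paths and labels

-- Directed, because the two searches treat opposite directions. Paths run towards the ancestor, so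
-- a walk r, r′, ... appears reversed, as `Traverses r′ r`.
data Traverses {n} (x y : Fin n) : List (Fin n) → Set where
  here  : ∀ {p} → Traverses x y (x ∷ y ∷ p)
  there : ∀ {u p} → Traverses x y p → Traverses x y (u ∷ p)

module PathProperties {c ℓ₁ ℓ₂} {F : OrderedField c ℓ₁ ℓ₂} {n} (G : RoadNetwork F n) where
  open OrderedFieldProperties F
  open RoadNetwork G
  open IsPath
  open IsShortestPath

  path-∷ : ∀ {S m v w p} → Adj m v → S m → IsPath G S v w p → IsPath G S m w (m ∷ p)
  path-∷ {p = v ∷ p} mv m∈S P with refl ← start P =
    record { linked = mv ∷ linked P ; start = refl ; end = end P ; inside = m∈S ∷ inside P }

  weight-∷ : ∀ {S m v w p} → IsPath G S v w p → weight G (m ∷ p) ≡ φ m v + weight G p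
  weight-∷ {p = v ∷ p} P with refl ← start P = refl

  path-tail : ∀ {S m v w x p} → IsPath G S m w (x ∷ v ∷ p) → IsPath G S v w (v ∷ p)
  path-tail record { linked = _ ∷ l ; end = e ; inside = _ ∷ i } =
    record { linked = l ; start = refl ; end = e ; inside = i }

  shortest-tail : ∀ {S m v w x p} → IsShortestPath G S m w (x ∷ v ∷ p) →
      IsShortestPath G S v w (v ∷ p)
  shortest-tail {m = m} {v} {p = p} sp with isPath sp
  ... | P@record { linked = mv ∷ _ ; start = refl ; inside = m∈S ∷ _ } = record
    { isPath = path-tail P
    ; minimal = λ {q} Q → +-cancelˡ-≤ (φ m v)
        (≤-trans (minimal sp (path-∷ mv m∈S Q)) (≤-reflexive (Eq.reflexive (weight-∷ Q)))) }

-- Shortest paths under the increase of a weight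

module IncreaseProperties {c ℓ₁ ℓ₂} {F : OrderedField c ℓ₁ ℓ₂} {n} (G : RoadNetwork F n)
  {a b} (ab : RoadNetwork.Adj G a b) (φ-new : OrderedField.Carrier F)
  (φ<φ-new : OrderedField._<_ F (RoadNetwork.φ G a b) φ-new) where
  open OrderedFieldProperties F
  open RoadNetwork G

  G′ : RoadNetwork F n
  G′ = increaseWeight G ab φ-new φ<φ-new

  open RoadNetwork G′ using () renaming (φ to φ′)

  φ′-updated : ∀ {u v} → (u ≡ a × v ≡ b) ⊎ (u ≡ b × v ≡ a) → φ′ u v ≡ φ-new
  φ′-updated {u} {v} s = cong (if_then φ-new else φ u v) (dec-true (sameEdge? {F = F} a b u v) s)

  φ′-other : ∀ {u v} → ¬ (u ≡ a × v ≡ b) → ¬ (u ≡ b × v ≡ a) → φ′ u v ≡ φ u v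
  φ′-other {u} {v} ≢ab ≢ba =
    cong (if_then φ-new else φ u v) (dec-false (sameEdge? {F = F} a b u v) [ ≢ab , ≢ba ]′)

  φ′-ab : φ a b < φ′ a b
  φ′-ab = subst (φ a b <_) (sym (φ′-updated (inj₁ (refl , refl)))) φ<φ-new

  φ′-ba : φ b a < φ′ b a
  φ′-ba = subst (φ b a <_) (sym (φ′-updated (inj₂ (refl , refl))))
    (≤-<-trans (≤-reflexive (φ-sym (adj-sym ab))) φ<φ-new)

  φ≤φ′ : ∀ u v → φ u v ≤ φ′ u v
  φ≤φ′ u v with sameEdge? {F = F} a b u v
  ... | yes (inj₁ (refl , refl)) = proj₁ φ′-ab
  ... | yes (inj₂ (refl , refl)) = proj₁ φ′-ba
  ... | no ¬s = ≤-reflexive (Eq.reflexive (sym (φ′-other (¬s ∘ inj₁) (¬s ∘ inj₂))))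

  weight-≤ : ∀ p → weight G p ≤ weight G′ p
  weight-≤ []          = ≤-refl
  weight-≤ (u ∷ [])    = ≤-refl
  weight-≤ (u ∷ v ∷ p) = +-mono-≤ (φ≤φ′ u v) (weight-≤ (v ∷ p))

  weight-< : ∀ {x y} → φ x y < φ′ x y → ∀ {p} → Traverses x y p → weight G p < weight G′ p
  weight-< {y = y} lt {_ ∷ _ ∷ p} here = +-mono-<-≤ lt (weight-≤ (y ∷ p))
  weight-< lt {u ∷ v ∷ p} (there t) = +-mono-≤-< (φ≤φ′ u v) (weight-< lt t)
  weight-< lt {u ∷ []} (there ())

  weight-≡ : ∀ p → ¬ Traverses a b p → ¬ Traverses b a p → weight G′ p ≡ weight G p
  weight-≡ []          _   _   = refl
  weight-≡ (u ∷ [])    _   _   = refl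
  weight-≡ (u ∷ v ∷ p) ¬ab ¬ba =
      cong₂ _+_ (φ′-other (λ { (refl , refl) → ¬ab here }) (λ { (refl , refl) → ¬ba here }))
                                        (weight-≡ (v ∷ p) (¬ab ∘ there) (¬ba ∘ there))

  path-G′ : ∀ {S v w p} → IsPath G S v w p → IsPath G′ S v w p
  path-G′ P = record { IsPath P }

  path-G : ∀ {S v w p} → IsPath G′ S v w p → IsPath G S v w p
  path-G P = record { IsPath P }

  open IsShortestPath

  -- If the path stays shortest, its length has changed; this is where sets of equal paths with
  -- different lengths count as different.
  heavier⇒¬same : ∀ {S v w p} → IsShortestPath G S v w p → weight G p < weight G′ p →
                  ¬ SameShortestPaths G G′ S v w
  heavier⇒¬same {p = p} sp lt same =
    proj₂ lt (sameLength p p sp (Equivalence.to (samePaths p) sp))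
    where open SameShortestPaths same

  -- Old shortest paths keep their weight and all others can only get heavier. The distance supplies
  -- an old shortest path against which a shortest path of G′ is measured.
  avoiding⇒same : ∀ {S v w x} → IsDistance G S v w x →
                  (∀ {p} → IsShortestPath G S v w p → ¬ Traverses a b p × ¬ Traverses b a p) →
                  SameShortestPaths G G′ S v w
  avoiding⇒same {S} {v} {w} dist avoid = record
    { samePaths  = λ p → mk⇔ to (from dist)
    ; sameLength = λ p q sp sq → antisym
        (≤-trans (minimal sp (path-G (isPath sq))) (weight-≤ q))
        (≤-trans (minimal sq (path-G′ (isPath sp))) (≤-reflexive (unchanged sp)))
    }
    where
    unchanged : ∀ {p} → IsShortestPath G S v w p → weight G′ p ≈ weight G p
    unchanged {p} sp = Eq.reflexive (weight-≡ p (proj₁ (avoid sp)) (proj₂ (avoid sp)))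

    to : ∀ {p} → IsShortestPath G S v w p → IsShortestPath G′ S v w p
    to sp = record
      { isPath  = path-G′ (isPath sp)
      ; minimal = λ {q} Q → ≤-trans (≤-reflexive (unchanged sp))
          (≤-trans (minimal sp (path-G Q)) (weight-≤ q)) }

    from : ∀ {p x} → IsDistance G S v w x → IsShortestPath G′ S v w p → IsShortestPath G S v w p
    from (infinite none) sp = contradiction (path-G (isPath sp)) (none _)
    from {p} (finite s₀ _) sp = record
      { isPath  = path-G (isPath sp)
      ; minimal = λ {q} Q → ≤-trans (weight-≤ p) (≤-trans (minimal sp (path-G′ (isPath s₀)))
                    (≤-trans (≤-reflexive (unchanged s₀)) (minimal s₀ Q))) }

-- Labels as distances to ancestors

module LabellingProperties {c ℓ₁ ℓ₂} {F : OrderedField c ℓ₁ ℓ₂} {n} {G : RoadNetwork F n}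
  (T : StableTreeHierarchy G) {_≤ₜ_ : Rel (Fin n) 0ℓ} (O : IsDecTotalOrder _≡_ _≤ₜ_)
  (L : Labels F n) (L-isLabelling : IsStableTreeLabelling T O L) where
  open OrderedFieldProperties F
  open RoadNetwork G
  open HierarchyProperties T O
  open PathProperties G
  open IsShortestPath

  label-distance : ∀ {v w} → Desc T O w v → IsDistance G (Desc T O w) v w (L v (τ T O w))
  label-distance {v} {w} w⪯v = L-isLabelling v (τ T O w) (τ-mono-≤ w⪯v) w w⪯v refl

  label-weight : ∀ {v w p} → Desc T O w v → IsShortestPath G (Desc T O w) v w p →
                 [ weight G p ] ≐ L v (τ T O w)
  label-weight {v} {w} w⪯v sp with L v (τ T O w) | label-distance w⪯v
  ... | _ | finite sp₀ eq = [ Eq.trans (antisym (minimal sp (isPath sp₀)) (minimal sp₀ (isPath sp)))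
      eq ]
  ... | _ | infinite none = contradiction (isPath sp) (none _)

  weight⇒shortest : ∀ {v w p} → Desc T O w v → IsPath G (Desc T O w) v w p →
                    [ weight G p ] ≐ L v (τ T O w) → IsShortestPath G (Desc T O w) v w p
  weight⇒shortest {v} {w} w⪯v P eq with L v (τ T O w) | label-distance w⪯v | eq
  ... | _ | finite sp₀ eq₀ | [ eq′ ] = record
    { isPath  = P
    ; minimal = λ Q → ≤-trans (≤-reflexive (Eq.trans eq′ (Eq.sym eq₀))) (minimal sp₀ Q) }

  label-triangle : ∀ {m v i} → Adj m v → i ℕ.≤ τ T O m → i ℕ.≤ τ T O v → L m i ≤⁺ φ m v +⁺ L v i
  label-triangle {m} {v} mv i≤m i≤v with ancestor-at v i≤v
  ... | w , w⪯v , refl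
    with L m (τ T O w) | label-distance (descend (adj-sym mv) w⪯v i≤m)
       | L v (τ T O w) | label-distance w⪯v
  ... | _ | _ | _ | infinite _ = _ ≤⊤⁺
  ... | _ | infinite none | _ | finite sp _ =
    contradiction (path-∷ mv (descend (adj-sym mv) w⪯v i≤m) (isPath sp)) (none _)
  ... | _ | finite {p} {x} sp eq | _ | finite {q} {y} sq eq′ = [ (begin
    x                  ≈⟨ eq ⟨
    weight G p         ≤⟨ minimal sp (path-∷ mv (descend (adj-sym mv) w⪯v i≤m) (isPath sq)) ⟩
    weight G (m ∷ q)   ≡⟨ weight-∷ (isPath sq) ⟩
    φ m v + weight G q ≈⟨ +-congˡ eq′ ⟩
    φ m v + y          ∎) ]
    where open ≤-Reasoning

  path-start : ∀ {v w p} → IsPath G (Desc T O w) v w p → Desc T O w v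
  path-start {p = v ∷ p} record { start = refl ; inside = v∈ ∷ _ } = v∈

  label-realized : ∀ {d v w x} → Desc T O w v → d +⁺ L v (τ T O w) ≐ x →
                   ∃ λ p → IsPath G (Desc T O w) v w p × [ d + weight G p ] ≐ x
  label-realized {d} {v} {w} w⪯v eq with L v (τ T O w) | label-distance w⪯v | eq
  ... | _ | finite {p} sp eq₀ | [ eq′ ] = p , isPath sp , [ Eq.trans (+-congˡ eq₀) eq′ ]

  traverses⇒tight : ∀ {v w x y p} → IsShortestPath G (Desc T O w) v w p → Traverses x y p →
                    φ x y +⁺ L y (τ T O w) ≐ L x (τ T O w)
  traverses⇒tight sp here with record { start = refl ; inside = x∈ ∷ y∈ ∷ _ } ← isPath sp =
    ≐-first (label-weight y∈ (shortest-tail sp)) (label-weight x∈ sp)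
  traverses⇒tight {p = _ ∷ _ ∷ _} sp (there trav) = traverses⇒tight (shortest-tail sp) trav
  traverses⇒tight {p = _ ∷ []} _ (there ())

-- The two searches

∈-indices⁻ : ∀ {i} m → i ∈ indices m → ∃ λ I → m ≡ just I × i ∈ᴵ I
∈-indices⁻ (just I) i∈ = I , refl , ∈-range⁻ I i∈

∈-indices⁺ : ∀ {i m} → (∃ λ I → m ≡ just I × i ∈ᴵ I) → i ∈ indices m
∈-indices⁺ (I , refl , i∈) = ∈-range⁺ I i∈

traverses-inside : ∀ {n ℓ x y p} {S : Pred (Fin n) ℓ} → Traverses x y p → All S p → S x × S y
traverses-inside here      (x∈ ∷ y∈ ∷ _) = x∈ , y∈
traverses-inside (there t) (_ ∷ p⊆S)     = traverses-inside t p⊆S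

module UpdateProperties {c ℓ₁ ℓ₂} {F : OrderedField c ℓ₁ ℓ₂} {n} {G : RoadNetwork F n}
  (T : StableTreeHierarchy G) {_≤ₜ_ : Rel (Fin n) 0ℓ} (O : IsDecTotalOrder _≡_ _≤ₜ_)
  (L : Labels F n) (L-isLabelling : IsStableTreeLabelling T O L)
  {a b} (ab : RoadNetwork.Adj G a b) (φ-new : OrderedField.Carrier F)
  (φ<φ-new : OrderedField._<_ F (RoadNetwork.φ G a b) φ-new)
  (0<φ : OrderedField._<_ F (OrderedField.0# F) (RoadNetwork.φ G a b)) where
  open OrderedFieldProperties F
  open RoadNetwork G

  open HierarchyProperties T O
  open PathProperties G
  open IncreaseProperties G ab φ-new φ<φ-new
  open LabellingProperties T O L L-isLabelling
  open RoadNetwork G′ using () renaming (φ to φ′; φ-sym to φ′-sym)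
  open Algorithm G G′ (τ T O)
  open IsShortestPath

  -- Shared by the two searches, with (r, r′) being (a, b) or (b, a). Both receive the weight
  -- `φ a b`, which matches the orientation of `edge` only up to `≈`.
  module _ {r r′} (edge : Adj r′ r) (φ≈ : φ a b ≈ φ r′ r) (heavier : φ r′ r < φ′ r′ r)
           {Δ : Carrier} (M : Labels F n) where
    open SearchProperties G G′ (τ T O) Δ r r′ (φ a b) 0<φ M

    walk⇒path : ∀ {d v w q} → Desc T O w r → IsPath G (Desc T O w) r w q → Walk (τ T O w) d v →
                ∃ λ p → IsPath G (Desc T O w) v w p × weight G p ≈ d + weight G q × Traverses r′ r p
    walk⇒path {q = r ∷ q} w⪯r Q (start _ i≤r′) with refl ← IsPath.start Q =
      r′ ∷ r ∷ q , path-∷ edge (descend (adj-sym edge) w⪯r i≤r′) Q , +-congʳ (Eq.sym φ≈) , here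
    walk⇒path {q = q} w⪯r Q (step {d} {u} {m} walk _ mu i≤m)
      with p , P , eq , t ← walk⇒path w⪯r Q walk =
      m ∷ p , path-∷ mu (descend (adj-sym mu) (path-start P) i≤m) P , (begin-equality
        weight G (m ∷ p)           ≡⟨ weight-∷ P ⟩
        φ m u + weight G p         ≈⟨ +-congˡ eq ⟩
        φ m u + (d + weight G q)   ≈⟨ x∙yz≈y∙xz (φ m u) d (weight G q) ⟩
        d + (φ m u + weight G q)   ≈⟨ +-assoc d (φ m u) (weight G q) ⟨
        d + φ m u + weight G q     ∎) , there t
      where open ≤-Reasoning

    -- Reversed and continued by a shortest path from `r`, a tight walk is a shortest path in G over
    -- the edge, and the update makes it heavier.
    reached⇒changed : ∀ {i d v} → Walk i d v → d +⁺ L r i ≐ L v i →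
                      ∃ λ w → Anc T O v w × ¬ SameShortestPaths G G′ (Desc T O w) v w
    reached⇒changed walk t with ancestor-at r (walk-indexʳ walk)
    ... | w , w⪯r , refl
      with q , Q , t′ ← label-realized w⪯r t
      with p , P , eq , trav ← walk⇒path w⪯r Q walk =
      w , w⪯v , heavier⇒¬same (weight⇒shortest w⪯v P (≐-respˡ-≈ (Eq.sym eq) t′))
          (weight-< heavier trav)
      where w⪯v = path-start P

    module _ {w} (w⪯r : Desc T O w r) (w⪯r′ : Desc T O w r′)
             (M-weight : ∀ {u p} → Desc T O w u → IsShortestPath G (Desc T O w) u w p →
                         [ weight G p ] ≐ M u (τ T O w))
             (triangle : ∀ {m v} → Adj m v → τ T O w ℕ.≤ τ T O m → τ T O w ℕ.≤ τ T O v →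
                         M m (τ T O w) ≤⁺ φ m v +⁺ M v (τ T O w)) where
      base : M r′ (τ T O w) ≤⁺ φ a b +⁺ M r (τ T O w)
      base = ≤⁺-trans (triangle edge (τ-mono-≤ w⪯r′) (τ-mono-≤ w⪯r))
          (+⁺-mono-≤⁺ (≤-reflexive (Eq.sym φ≈)) ≤⁺-refl)

      open Column (τ T O w) (τ-mono-≤ w⪯r) (τ-mono-≤ w⪯r′) triangle base public

      path⇒chain : ∀ {v p} → IsShortestPath G (Desc T O w) v w p → Traverses r′ r p →
                   ∃ λ d → Chain d v
      path⇒chain {p = r′ ∷ r ∷ p} sp here with refl ← IsPath.start (isPath sp) =
        φ a b , start (≐-first (M-weight w⪯r (shortest-tail sp))
                        (≐-respˡ-≈ (+-congʳ (Eq.sym φ≈)) (M-weight w⪯r′ sp)))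
      path⇒chain {p = m ∷ u ∷ p} sp (there trav)
        with d , ch ← path⇒chain (shortest-tail sp) trav
        with record { linked = mu ∷ _ ; start = refl ; inside = m∈ ∷ u∈ ∷ _ } ← isPath sp =
        d + φ m u , step ch mu (τ-mono-≤ m∈)
          (≐-next (chain-tight ch) (M-weight u∈ (shortest-tail sp)) (M-weight m∈ sp))
      path⇒chain {p = _ ∷ []} _ (there ())

  module _ (run : ParetoIncreaseRun a b (φ a b) φ-new L) where
    open ParetoIncreaseRun run
    private
      Δ = φ-new - φ a b
      module S₁ = SearchProperties G G′ (τ T O) Δ a b (φ a b) 0<φ L
      module S₂ = SearchProperties G G′ (τ T O) Δ b a (φ a b) 0<φ L₁
      module R₁ = SearchRun first
      module R₂ = SearchRun second
    open SearchProperties.Sound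

    sound₁ : S₁.Sound [] R₁.final
    sound₁ = S₁.search-sound R₁.search

    affected≤τ : ∀ {v i} → i ∈ indices (R₁.affected v) → i ℕ.≤ τ T O v
    affected≤τ {v} i∈ =
      let A , eq , _ , i≤max = ∈-indices⁻ (R₁.affected v) i∈
      in ℕ.≤-trans i≤max (proj₂ (proj₂ (hull sound₁ eq)))

    labels-increase : ∀ v i → L v i ≤⁺ R₁.labels v i
    labels-increase v i with status sound₁ v i
    ... | inj₁ eq = ≤⁺-reflexive (sym eq)
    ... | inj₂ p  = ≤⁺-trans (x≤⁺y+⁺x (x≤y⇒0≤y-x (proj₁ φ<φ-new)))
        (≤⁺-reflexive (sym (S₁.Passed.increase p)))

    triangle′ : ∀ {m v i} → Adj m v → i ℕ.≤ τ T O m → i ℕ.≤ τ T O v → L m i ≤⁺ φ′ m v +⁺ L v i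
    triangle′ {m} {v} mv i≤m i≤v =
      ≤⁺-trans (label-triangle mv i≤m i≤v) (+⁺-mono-≤⁺ (φ≤φ′ m v) ≤⁺-refl)

    open RepairProperties.From G G′ (τ T O) R₁.affected affected≤τ L R₁.labels
        (λ {v} {i} _ → labels-increase v i) triangle′

    repaired : Relaxing [] L₁
    repaired = repair-relaxed R₁.repair

    open Relaxing repaired

    -- At affected entries the repair has relaxed the edge. Elsewhere `L₁` has not risen above `L`
    -- at `m` nor fallen below it at `v`, so the inequality is inherited from `L`.
    L₁-triangle : ∀ {m v i} → Adj m v → i ℕ.≤ τ T O m → i ℕ.≤ τ T O v → L₁ m i ≤⁺ φ′ m v +⁺ L₁ v i
    L₁-triangle {m} {v} {i} mv i≤m i≤v with i ∈? indices (R₁.affected m)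
      where open DecMembership ℕ._≟_ using (_∈?_)
    ... | yes i∈ with inj₁ le ← relaxed (adj-sym mv) i∈ i≤v =
      ≤⁺-trans le (+⁺-mono-≤⁺ (≤-reflexive (φ′-sym (adj-sym mv))) ≤⁺-refl)
    ... | no i∉ with status sound₁ m i
    ...   | inj₂ p  = contradiction (∈-indices⁺ (S₁.Passed.covered p)) i∉
    ...   | inj₁ eq = ≤⁺-trans (upper m i) (≤⁺-trans (≤⁺-reflexive eq)
                        (≤⁺-trans (triangle′ mv i≤m i≤v) (+⁺-mono-≤⁺ ≤-refl (lower i≤v))))

    -- The i-th ancestor has a shortest path to b through the edge from a.
    Via : ℕ → Set _
    Via i = φ a b +⁺ L a i ≐ L b i

    -- Tightness far out forces it on the first edge: the rest of the walk cancels, and the triangle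
    -- inequality gives the converse bound.
    reached⇒via : ∀ {v i} → S₁.Reached v i → Via i
    reached⇒via (d , walk , t) = ≐-antisym t
      (≐-shift t (S₁.walk-shift (λ _ _ → label-triangle) walk (S₁.tight⇒≢ walk t)))
      (≤⁺-trans (label-triangle (adj-sym ab) (S₁.walk-indexʳ′ walk) (S₁.walk-indexʳ walk))
        (+⁺-mono-≤⁺ (≤-reflexive (φ-sym (adj-sym ab))) ≤⁺-refl))

    ¬via⇒unaffected : ∀ {i v} → ¬ Via i → L₁ v i ≤⁺ L v i
    ¬via⇒unaffected {i} {v} ¬via with status sound₁ v i
    ... | inj₁ eq = ≤⁺-trans (upper v i) (≤⁺-reflexive eq)
    ... | inj₂ p  = contradiction (reached⇒via (S₁.Passed.reached p)) ¬via

    -- The walk avoids b after its first edge, so the triangle inequality in G′ bounds L₁ v by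
    -- L₁ a and the rest of the walk; but a is closer to the ancestor than b.
    via⇒¬reached : ∀ {v i} → Via i → ¬ S₂.Reached v i
    via⇒¬reached {v} {i} via (d , walk , t) = ≐-asym 0<φ via
      (≤⁺-trans (+⁺-mono-≤⁺ ≤-refl (lower (S₂.walk-indexʳ walk)))
        (≤⁺-trans (≐-shift t (S₂.walk-shift triangle walk (S₂.tight⇒≢ walk t)))
          (≤⁺-trans (upper a i) (≤⁺-reflexive (S₁.Sound.labels-root sound₁ i)))))
      where
      triangle : ∀ {m v} → m ≢ b → v ≢ b → Adj m v → i ℕ.≤ τ T O m → i ℕ.≤ τ T O v →
          L₁ m i ≤⁺ φ m v +⁺ L₁ v i
      triangle {m} {v} m≢b v≢b mv i≤m i≤v =
        subst (λ x → L₁ m i ≤⁺ x +⁺ L₁ v i) (φ′-other (v≢b ∘ proj₂) (m≢b ∘ proj₁))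
            (L₁-triangle mv i≤m i≤v)

    Changed : Pred (Fin n) _
    Changed v = ∃ λ w → Anc T O v w × ¬ SameShortestPaths G G′ (Desc T O w) v w

    first-sound : ∀ {v} → v ∈ R₁.propagated → Changed v
    first-sound v∈ =
      let _ , _ , walk , t = visits sound₁ v∈
      in reached⇒changed (adj-sym ab) (φ-sym ab) φ′-ba L walk t

    second-sound : ∀ {v} → v ∈ R₂.propagated → Changed v
    second-sound {v} v∈ with visits (S₂.search-sound R₂.search) v∈
    ... | i , d , walk , t with φ a b +⁺ L a i ≐? L b i
    ...   | yes via = contradiction (d , walk , t) (via⇒¬reached via)
    ...   | no ¬via = reached⇒changed ab Eq.refl φ′-ab L₁ walk (+⁺-≐-resp-≤⁺
              (¬via⇒unaffected ¬via) (lower (S₂.walk-indexʳ walk))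
              (¬via⇒unaffected ¬via) (lower (S₂.walk-index walk)) t)

    first-complete : ∀ {v w p} → IsShortestPath G (Desc T O w) v w p → Traverses b a p →
        v ∈ R₁.propagated
    first-complete {w = w} sp trav =
      let w⪯b , w⪯a = traverses-inside trav (IsPath.inside (isPath sp))
          _ , ch = path⇒chain (adj-sym ab) (φ-sym ab) φ′-ba L w⪯a w⪯b label-weight label-triangle sp
              trav
      in S₁.Column.search-complete _ _ _ _ _ R₁.search ch

    second-complete : ∀ {v w p} → IsShortestPath G (Desc T O w) v w p → Traverses a b p →
        v ∈ R₂.propagated
    second-complete {w = w} sp trav =
      let w⪯a , w⪯b = traverses-inside trav (IsPath.inside (isPath sp))
          _ , ch = path⇒chain ab Eq.refl φ′-ab L₁ w⪯b w⪯a
            (λ w⪯u sp → ≐-resp-≤⁺ (lower (τ-mono-≤ w⪯u)) (¬via⇒unaffected ¬via)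
                (label-weight w⪯u sp))
            (λ mv i≤m i≤v → ≤⁺-trans (¬via⇒unaffected ¬via)
              (≤⁺-trans (label-triangle mv i≤m i≤v) (+⁺-mono-≤⁺ ≤-refl (lower i≤v))))
            sp trav
      in S₂.Column.search-complete _ _ _ _ _ R₂.search ch
      where
      -- The path makes the edge tight from a to b, and positivity excludes the opposite direction.
      ¬via : ¬ Via (τ T O w)
      ¬via via = ≐-asym 0<φ via (≐⇒≤⁺ (traverses⇒tight sp trav))

    -- No path can be extracted from the negated sameness. Membership in the two lists is decided
    -- instead: if both fail, completeness keeps every shortest path off the edge, so nothing has
    -- changed.
    changed⇒propagated : ∀ v → Changed v → V⁺Δ run v
    changed⇒propagated v (w , w⪯v , ¬same) with v ∈? R₁.propagated | v ∈? R₂.propagated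
      where open DecMembership (_≟_ {n}) using (_∈?_)
    ... | yes v∈ | _      = inj₁ v∈
    ... | no _   | yes v∈ = inj₂ v∈
    ... | no v∉₁ | no v∉₂ = contradiction
      (avoiding⇒same (label-distance w⪯v) λ sp → v∉₂ ∘ second-complete sp , v∉₁ ∘ first-complete sp)
          ¬same

lemma6p5 : ∀ {c ℓ₁ ℓ₂} (F : OrderedField c ℓ₁ ℓ₂) {n : ℕ} (G : RoadNetwork F n)
    (T : StableTreeHierarchy G)
    {_≤ₜ_ : Rel (Fin n) 0ℓ} (O : IsDecTotalOrder _≡_ _≤ₜ_)
    (L : Labels F n) → IsStableTreeLabelling T O L →
    let open OrderedField F
        open RoadNetwork G in
    ∀ {a b} (ab : Adj a b) (φ-new : Carrier) (φ-old<φ-new : φ a b < φ-new) →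
    0# < φ a b →
    let G′ = increaseWeight G ab φ-new φ-old<φ-new
        open Algorithm G G′ (τ T O) in
    (run : ParetoIncreaseRun a b (φ a b) φ-new L) →
    ∀ v → V⁺Δ run v ⇔
          (∃ λ r → Anc T O v r × ¬ SameShortestPaths G G′ (Desc T O r) v r)
lemma6p5 F G T O L isL ab φ-new φ-old<φ-new 0<φ run v =
  mk⇔ [ first-sound run , second-sound run ]′ (changed⇒propagated run v)
  where open UpdateProperties T O L isL ab φ-new φ-old<φ-new 0<φ
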